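{- Let $p>2$ be a prime, let $t$ be a positive divisor of $p-1$, let $k>1$ be an integer, let $s\in\mathbb{N}$ and let $a\in\mathbb{F}_p^*$. Put $r=r_2(k)=\left\lfloor\frac{\log(p/2)}{8\log k}-\frac14\right\rfloor$. Then $$\#V(k,t,a)\le\max\left(2\tilde\Phi(k^2,s-1),\ \binom{r+s}{s}^{ -1}t\right).$$
   Context: $\mathbb{F}_p$ is the field of residues modulo $p$. For $x\in\mathbb{F}_p$, the rational height is $\|x\|=\min\{\max(|a|,b)~:~a\in\mathbb{Z},\ b\in\mathbb{N},\ a\equiv bx \pmod p\}$. For $t\mid p-1$, $G$ is the unique subgroup of $\mathbb{F}_p^*$ of order $t$, $aG=\{ag:g\in G\}$, and $V(k,t,a)=\{x\in aG~:~\|x\|\le k\}$. $\Psi(x,y)$ is the number of positive integers $n\le x$ all of whose prime factors are at most $y$; $p_j$ is the $j$-th prime ($p_1=2$), with the convention $\Psi(x,p_0)=1$ for $x\ge 1$. For $m\in\mathbb{N}$, $\tilde\Phi(x,m)=\sum_{i=0}^{m}\binom{m}{i}\Psi(x,p_i)\Psi(x,p_{m-i})$, and $\tilde\Phi(x,0)=1$. -}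

module Defs where

open import Data.Nat using (ℕ; zero; suc; _+_; _*_; _∸_; _^_; _≤_; _<_; _≤?_; _%_)
open import Data.Nat.Divisibility using (_∣?_)
open import Data.Nat.Primality using (prime?)
open import Data.Nat.Combinatorics using (_C_)
open import Data.Nat.Base using (_!)
open import Data.Bool using (Bool; true; false; not; _∧_; _∨_; if_then_else_)
open import Data.List using (List; []; _∷_; length; filter; map; upTo)
open import Data.Nat.ListAction using (sum)
open import Data.Bool.ListAction using (and)
open import Data.List.Membership.Propositional using (_∈_)
open import Data.List.Relation.Unary.Unique.Propositional using (Unique)
open import Data.List.Relation.Unary.All using (All)
open import Data.Integer as ℤ using (ℤ; +_; ∣_∣)
open import Data.Integer.Divisibility using () renaming (_∣_ to _∣ℤ_)
open import Data.Product using (Σ; _×_; ∃)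
open import Relation.Nullary.Decidable using (⌊_⌋; yes; no)
open import Relation.Nullary.Decidable using (T?)
open import Relation.Binary.PropositionalEquality using (_≡_)

-- Elements of F_p are represented by residues x with x < p.

_≡ℤ_[mod_] : ℤ → ℤ → ℕ → Set
x ≡ℤ y [mod p ] = (+ p) ∣ℤ (x ℤ.- y)

-- ‖x‖ ≤ k  :  there are a ∈ ℤ, b ∈ ℕ, b ≥ 1, with a ≡ b x (mod p)
-- and max(|a|, b) ≤ k   (this is exactly "min{...} ≤ k").
HeightLE : (p k x : ℕ) → Set
HeightLE p k x =
  Σ ℤ λ a → Σ ℕ λ b →
    (1 ≤ b) × (∣ a ∣ ≤ k) × (b ≤ k) × (a ≡ℤ (+ (b * x)) [mod p ])

-- A subgroup of F_p^* of order t, given by a duplicate-free list of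
-- its elements (residues in [1, p-1]) closed under multiplication mod p
-- and containing 1 (in a finite group this makes it a subgroup).
record Subgroup (p t : ℕ) : Set where
  field
    elems   : List ℕ
    unique  : Unique elems
    inRange : All (λ g → (1 ≤ g) × (g < p)) elems
    one∈    : 1 ∈ elems
    closed  : ∀ {g h} → g ∈ elems → h ∈ elems →
              Σ ℕ λ q → (q ∈ elems) × ((+ q) ≡ℤ (+ (g * h)) [mod p ])
    order   : length elems ≡ t

InCoset : {p t : ℕ} → Subgroup p t → (a x : ℕ) → Set
InCoset {p} G a x =
  Σ ℕ λ g → (g ∈ Subgroup.elems G) × ((+ x) ≡ℤ (+ (a * g)) [mod p ])

InV : {p t : ℕ} → Subgroup p t → (k a x : ℕ) → Set
InV {p} G k a x = (x < p) × InCoset G a x × HeightLE p k x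

-- #V(k,t,a) ≤ N  :  every duplicate-free list of elements of V has length ≤ N
-- (stated via lists).

-- y-smooth: every prime factor q of n satisfies q ≤ y
-- (prime factors of n ≥ 1 are ≤ n, so checking q ≤ n suffices)
smooth : (y n : ℕ) → Bool
smooth y n = and (map (λ q → not (⌊ prime? q ⌋ ∧ ⌊ q ∣? n ⌋) ∨ ⌊ q ≤? y ⌋) (upTo (suc n)))

Ψ : (x y : ℕ) → ℕ
Ψ x y = length (filter (λ n → T? (smooth y (suc n))) (upTo x))

-- least prime in (n, n! + 1]  (exists by Euclid's argument)
firstPrimeFrom : (start fuel : ℕ) → ℕ
firstPrimeFrom start zero = start
firstPrimeFrom start (suc fuel) with prime? start
... | yes _ = start
... | no  _ = firstPrimeFrom (suc start) fuel

nextPrime : ℕ → ℕ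
nextPrime n = firstPrimeFrom (suc n) (n !)

-- pr j = p_j, the j-th prime (p_1 = 2); pr 0 = 1, so that
-- Ψ(x, pr 0) = Ψ(x, 1) = 1 for x ≥ 1, matching the convention Ψ(x,p_0) = 1.
pr : ℕ → ℕ
pr zero    = 1
pr (suc j) = nextPrime (pr j)

Φ̃ : (x m : ℕ) → ℕ
Φ̃ x m = sum (map (λ i → (m C i) * Ψ x (pr i) * Ψ x (pr (m ∸ i))) (upTo (suc m)))

{-# OPTIONS --safe #-}

-- Write each x in V as a fraction u / v with |u|, v ≤ k, and attach to it the integer vector of
-- its valuations ν_q(x) = val_q(u) − val_q(v) over the primes q ≤ k.  Gaussian elimination on
-- these vectors, run for s steps, has two outcomes.
--
-- If it stops early, fewer than s primes determine all the vectors.  Splitting these primes into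
-- those with ν_q ≥ 0 and those with ν_q < 0, and replacing the j-th one of each kind by the j-th
-- prime p_j, maps |x| injectively to a pair of smooth numbers ≤ k²; Φ̃(k², s − 1) counts the
-- possible images, and the sign of x gives the factor 2.
--
-- Otherwise, taking for each pivot a pair of points of V at which it is largest and smallest, one
-- gets s ratios w_1, …, w_s such that x ∏ w_i^(2 e_i) = x′ ∏ w_i^(2 e′_i) in ℚ forces e = e′: twice
-- the spread of the pivot cannot be made up by the difference of two points.  The products
-- x ∏ w_i^(2 e_i) with e_1 + … + e_s ≤ r lie in the coset aG, and by 2 k^(8r+2) < p their heights
-- are small enough for congruence modulo p to mean equality in ℚ.  Hence #V · C(r+s, s) ≤ t.

module Submission where

open import Defs
open import Data.Bool using (Bool; true; false; T; not; _∧_; _∨_; if_then_else_)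
open import Data.Bool.ListAction using (and)
open import Data.Empty using (⊥-elim)
open import Data.Fin using (Fin; toℕ; fromℕ<)
open import Data.List using (List; []; _∷_; _++_; [_]; length; map; filter; lookup; upTo; applyUpTo; allFin; cartesianProduct)
open import Data.List.Properties using (length-++; length-map; length-tabulate; map-++; map-upTo; applyUpTo-∷ʳ)
open import Data.List.Membership.Propositional using (_∈_; find; lose)
open import Data.List.Membership.Propositional.Properties using (∈-∃++; ∈-++⁻; ∈-++⁺ˡ; ∈-++⁺ʳ; ∈-map⁺; ∈-map⁻; ∈-filter⁺; ∈-filter⁻; ∈-upTo⁺; ∈-allFin; ∈-lookup; ∈-cartesianProduct⁺; ∈-cartesianProduct⁻)
open import Data.List.Relation.Unary.Any using (here; there; any?)
open import Data.List.Relation.Unary.All as All using (All; []; _∷_)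
import Data.List.Relation.Unary.All.Properties as Allₚ
open import Data.List.Relation.Unary.AllPairs as AllPairs using (AllPairs; []; _∷_)
import Data.List.Relation.Unary.AllPairs.Properties as AllPairsₚ
open import Data.List.Relation.Unary.Unique.Propositional using (Unique)
import Data.List.Relation.Unary.Unique.Propositional.Properties as Uniqueₚ
open import Data.List.Relation.Binary.Permutation.Propositional using (_↭_; ↭-refl; ↭-sym; ↭-trans; prep)
open import Data.List.Relation.Binary.Permutation.Propositional.Properties using (shift; map⁺)
open import Data.Nat as ℕ using (ℕ; zero; suc; z≤n; s≤s; z<s; NonZero; >-nonZero; >-nonZero⁻¹)
import Data.Nat.Divisibility as ℕ
import Data.Nat.Properties as ℕ
open import Data.Nat.Combinatorics using (_C_; nCk+nC[k+1]≡[n+1]C[k+1]; k>n⇒nCk≡0; nCn≡1)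
open import Data.Nat.ListAction using (sum; product)
open import Data.Nat.ListAction.Properties using (sum-++; sum-↭; product-++; product-↭; ∈⇒∣product)
open import Data.Nat.Primality using (Prime; prime?; prime⇒nonZero; prime⇒nonTrivial; prime⇒irreducible; euclidsLemma; ¬prime[1])
open import Data.Nat.Primality.Factorisation using (PrimeFactorisation; factors; factorise; factorisationUnique)
open import Data.Product using (∃; _×_; _,_; proj₁; proj₂; map₁)
open import Data.Product.Properties using (,-injective)
open import Data.Sign as Sign using (Sign)
open import Data.Sum using (_⊎_; inj₁; inj₂)
open import Data.Unit using (tt)
open import Data.Vec as Vec using (Vec; []; _∷_)
open import Function using (_∘_; id)
open import Level using (0ℓ)
open import Relation.Binary.Bundles using (Setoid)
open import Relation.Binary.Definitions using (tri<; tri≈; tri>)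
open import Relation.Binary.PropositionalEquality hiding ([_])
import Relation.Binary.Reasoning.Setoid as SetoidReasoning
open import Relation.Nullary using (¬_; yes; no; contradiction)
open import Relation.Nullary.Decidable using (⌊_⌋; T?; _×-dec_)

module _ where

  open import Data.Nat using (_+_; _*_; _∸_; _^_; _≤_; _<_; _≤?_; _!)
  open import Data.Nat.Properties
  open import Data.Nat.Divisibility using (_∣_; _∣?_; ∣⇒≤; ∣-trans; m∣m*n; m≤n⇒m!∣n!; ∣m+n∣m⇒∣n; ∣1⇒≡1)
  open import Algebra.Properties.CommutativeSemigroup *-commutativeSemigroup using (x∙yz≈y∙xz)
  open import Algebra.Properties.CommutativeSemigroup +-commutativeSemigroup using () renaming (interchange to +-interchange; x∙yz≈y∙xz to +-x∙yz≈y∙xz)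

  -- Finite lists and counting by injections.

  length-cartesianProduct : {A B : Set} (xs : List A) (ys : List B) →
    length (cartesianProduct xs ys) ≡ length xs * length ys
  length-cartesianProduct []       ys = refl
  length-cartesianProduct (x ∷ xs) ys = trans (length-++ (map (x ,_) ys))
    (cong₂ _+_ (length-map (x ,_) ys) (length-cartesianProduct xs ys))

  ∈-remove : {A : Set} {y z : A} (as : List A) {bs : List A} → z ∈ as ++ y ∷ bs → z ≡ y ⊎ z ∈ as ++ bs
  ∈-remove as z∈ with ∈-++⁻ as z∈
  ... | inj₁ z∈as           = inj₂ (∈-++⁺ˡ z∈as)
  ... | inj₂ (here z≡y)     = inj₁ z≡y
  ... | inj₂ (there z∈bs)   = inj₂ (∈-++⁺ʳ as z∈bs)

  length-remove : {A : Set} {y : A} (as : List A) {bs : List A} →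
    length (as ++ y ∷ bs) ≡ suc (length (as ++ bs))
  length-remove []       = refl
  length-remove (_ ∷ as) = cong suc (length-remove as)

  -- The image of the head is removed from `ys`, and injectivity keeps the images of the tail in
  -- what remains. `R` is a relation because images are found together with membership proofs and,
  -- in the group, only modulo p.
  pigeonhole : {A B : Set} (R : A → B → Set) {xs : List A} {ys : List B} → Unique xs →
    (∀ {x} → x ∈ xs → ∃ λ y → y ∈ ys × R x y) →
    (∀ {x x′ y} → x ∈ xs → x′ ∈ xs → R x y → R x′ y → x ≡ x′) →
    length xs ≤ length ys
  pigeonhole R []           hit inj = z≤n
  pigeonhole R (x∉xs ∷ xs!) hit inj with hit (here refl)
  ... | y , y∈ys , Rxy with ∈-∃++ y∈ys
  ... | as , bs , refl = subst (_ ≤_) (sym (length-remove as))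
    (s≤s (pigeonhole R xs! hit′ (λ p q → inj (there p) (there q))))
    where
    hit′ : ∀ {x′} → x′ ∈ _ → ∃ λ y′ → y′ ∈ as ++ bs × R x′ y′
    hit′ x′∈ with hit (there x′∈)
    ... | y′ , y′∈ , Rx′y′ with ∈-remove as y′∈
    ... | inj₂ y′∈′ = y′ , y′∈′ , Rx′y′
    ... | inj₁ refl = ⊥-elim (All.lookup x∉xs x′∈ (inj (here refl) (there x′∈) Rxy Rx′y′))

  unique-⊆-length : {A : Set} {xs ys : List A} → Unique xs → (∀ {x} → x ∈ xs → x ∈ ys) →
    length xs ≤ length ys
  unique-⊆-length xs! sub = pigeonhole _≡_ xs! (λ x∈ → _ , sub x∈ , refl) (λ { _ _ refl refl → refl })

  -- Valuations

  δ : ℕ → ℕ → ℕ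
  δ q x = if ⌊ q ≟ x ⌋ then 1 else 0

  δ-refl : ∀ q → δ q q ≡ 1
  δ-refl q with q ≟ q
  ... | yes _  = refl
  ... | no q≢q = contradiction refl q≢q

  δ-≢ : ∀ {q x} → q ≢ x → δ q x ≡ 0
  δ-≢ {q} {x} q≢x with q ≟ x
  ... | yes q≡x = contradiction q≡x q≢x
  ... | no _    = refl

  count : ℕ → List ℕ → ℕ
  count q xs = sum (map (δ q) xs)

  count-↭ : ∀ q {xs ys} → xs ↭ ys → count q xs ≡ count q ys
  count-↭ q xs↭ys = sum-↭ (map⁺ (δ q) xs↭ys)

  count-++ : ∀ q xs ys → count q (xs ++ ys) ≡ count q xs + count q ys
  count-++ q xs ys = trans (cong sum (map-++ (δ q) xs ys)) (sum-++ (map (δ q) xs) (map (δ q) ys))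

  count≢0⇒∈ : ∀ q xs → count q xs ≢ 0 → q ∈ xs
  count≢0⇒∈ q []       c≢0 = contradiction refl c≢0
  count≢0⇒∈ q (x ∷ xs) c≢0 with q ≟ x
  ... | yes refl = here refl
  ... | no  _    = there (count≢0⇒∈ q xs c≢0)

  count-head≢0 : ∀ x xs → count x (x ∷ xs) ≢ 0
  count-head≢0 x xs eq with trans (sym (cong (_+ count x xs) (δ-refl x))) eq
  ... | ()

  count-ext : ∀ xs ys → (∀ q → count q xs ≡ count q ys) → xs ↭ ys
  count-ext []       []       eq = ↭-refl
  count-ext []       (y ∷ ys) eq = contradiction (sym (eq y)) (count-head≢0 y ys)
  count-ext (x ∷ xs) ys       eq
    with ∈-∃++ (count≢0⇒∈ x ys (λ c≡0 → count-head≢0 x xs (trans (eq x) c≡0)))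
  ... | as , bs , refl = ↭-trans (prep x (count-ext xs (as ++ bs) eq′)) (↭-sym (shift x as bs))
    where
    eq′ : ∀ q → count q xs ≡ count q (as ++ bs)
    eq′ q = +-cancelˡ-≡ (δ q x) _ _ (trans (eq q) (count-↭ q (shift x as bs)))

  -- The multiplicity of q among the prime factors of n. It vanishes when q is not prime, so `val-*`
  -- and `val-ext` can range over all q. The value at 0 is a default.
  val : ℕ → ℕ → ℕ
  val q zero      = 0
  val q n@(suc _) = count q (factors (factorise n))

  -- Uniqueness of factorisation lets any list of primes with product n compute the valuation.
  val-factors : ∀ q {n} fs .{{_ : NonZero n}} → All Prime fs → n ≡ product fs → val q n ≡ count q fs
  val-factors q {suc n} fs ps eq = count-↭ q (factorisationUnique (factorise (suc n))
    (record { factors = fs ; isFactorisation = eq ; factorsPrime = ps }))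

  record Factored (n : ℕ) : Set where
    field
      list    : List ℕ
      primes  : All Prime list
      product≡ : n ≡ product list
      count≡  : ∀ q → val q n ≡ count q list

  factored : ∀ n .{{_ : NonZero n}} → Factored n
  factored n@(suc _) = record
    { list = factors f ; primes = PrimeFactorisation.factorsPrime f
    ; product≡ = PrimeFactorisation.isFactorisation f ; count≡ = λ q → refl }
    where f = factorise n

  val-* : ∀ q m n .{{_ : NonZero m}} .{{_ : NonZero n}} → val q (m * n) ≡ val q m + val q n
  val-* q m n = begin
    val q (m * n)              ≡⟨ val-factors q (M.list ++ N.list) {{m*n≢0 m n}} (Allₚ.++⁺ M.primes N.primes)
                                    (trans (cong₂ _*_ M.product≡ N.product≡) (sym (product-++ M.list N.list))) ⟩
    count q (M.list ++ N.list) ≡⟨ count-++ q M.list N.list ⟩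
    count q M.list + count q N.list ≡⟨ cong₂ _+_ (M.count≡ q) (N.count≡ q) ⟨
    val q m + val q n ∎
    where
    open ≡-Reasoning
    module M = Factored (factored m)
    module N = Factored (factored n)

  val-^ : ∀ q n e .{{_ : NonZero n}} → val q (n ^ e) ≡ e * val q n
  val-^ q n zero    = val-factors q [] [] refl
  val-^ q n (suc e) = trans (val-* q n (n ^ e)) (cong (val q n +_) (val-^ q n e))
    where instance _ = m^n≢0 n e

  val-prime : ∀ {q} → Prime q → val q q ≡ 1
  val-prime {q} pq = trans (val-factors q (q ∷ []) {{prime⇒nonZero pq}} (pq ∷ []) (sym (*-identityʳ q)))
    (trans (+-identityʳ (δ q q)) (δ-refl q))

  val≢0⇒prime-divisor : ∀ q n → val q n ≢ 0 → Prime q × q ∣ n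
  val≢0⇒prime-divisor q zero      v≢0 = contradiction refl v≢0
  val≢0⇒prime-divisor q n@(suc _) v≢0 =
    All.lookup primes q∈ , subst (q ∣_) (sym product≡) (∈⇒∣product q∈)
    where
    open Factored (factored n)
    q∈ = count≢0⇒∈ q list v≢0

  val-∤ : ∀ q n → ¬ q ∣ n → val q n ≡ 0
  val-∤ q n q∤n with val q n ≟ 0
  ... | yes eq = eq
  ... | no neq = contradiction (proj₂ (val≢0⇒prime-divisor q n neq)) q∤n

  val-> : ∀ q n .{{_ : NonZero n}} → n < q → val q n ≡ 0
  val-> q n n<q = val-∤ q n (λ q∣n → <⇒≱ n<q (∣⇒≤ q∣n))

  val-ext : ∀ m n .{{_ : NonZero m}} .{{_ : NonZero n}} → (∀ q → val q m ≡ val q n) → m ≡ n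
  val-ext m n eq = trans M.product≡ (trans (product-↭ (count-ext M.list N.list
      (λ q → trans (sym (M.count≡ q)) (trans (eq q) (N.count≡ q))))) (sym N.product≡))
    where
    module M = Factored (factored m)
    module N = Factored (factored n)

  -- Products of prime powers over a list of primes.

  Π-pow : (ℕ → ℕ) → List ℕ → ℕ
  Π-pow e L = product (map (λ q → q ^ e q) L)

  Π-pow-cong : ∀ {e e′} L → (∀ {q} → q ∈ L → e q ≡ e′ q) → Π-pow e L ≡ Π-pow e′ L
  Π-pow-cong []      eq = refl
  Π-pow-cong (q ∷ L) eq = cong₂ (λ a b → q ^ a * b) (eq (here refl)) (Π-pow-cong L (eq ∘ there))

  Π-pow-mono : ∀ {e e′} L → (∀ {q} → q ∈ L → NonZero q) → (∀ q → e q ≤ e′ q) → Π-pow e L ≤ Π-pow e′ L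
  Π-pow-mono []      nz le = ≤-refl
  Π-pow-mono (q ∷ L) nz le = *-mono-≤ (^-monoʳ-≤ q {{nz (here refl)}} (le q)) (Π-pow-mono L (nz ∘ there) le)

  -- `L` has no repetitions, so f occurs in it at most once and at most one factor of the product
  -- gains an f.
  Π-pow-count-∷ : ∀ f fs {L} .{{_ : NonZero f}} → Unique L →
    Π-pow (λ q → count q (f ∷ fs)) L ≤ f * Π-pow (λ q → count q fs) L
  Π-pow-count-∷ f fs []  = subst (1 ≤_) (sym (*-identityʳ f)) (>-nonZero⁻¹ f)
  Π-pow-count-∷ f fs {q ∷ L} (q∉L ∷ L!) with q ≟ f
  ... | yes refl = ≤-reflexive (trans (cong (λ z → q * q ^ count q fs * z)
          (Π-pow-cong L (λ {x} x∈ → cong (_+ count x fs) (δ-≢ (λ x≡q → All.lookup q∉L x∈ (sym x≡q))))))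
          (*-assoc q (q ^ count q fs) _))
  ... | no _ = begin
    q ^ count q fs * Π-pow (λ x → count x (f ∷ fs)) L ≤⟨ *-monoʳ-≤ (q ^ count q fs) (Π-pow-count-∷ f fs L!) ⟩
    q ^ count q fs * (f * Π-pow (λ x → count x fs) L) ≡⟨ x∙yz≈y∙xz (q ^ count q fs) f _ ⟩
    f * (q ^ count q fs * Π-pow (λ x → count x fs) L) ∎
    where open ≤-Reasoning

  Π-pow-count≤ : ∀ fs {L} → All Prime fs → Unique L → Π-pow (λ q → count q fs) L ≤ product fs
  Π-pow-count≤ [] {L} [] L! = ≤-reflexive (Π-1 L)
    where
    Π-1 : ∀ L → Π-pow (λ _ → 0) L ≡ 1
    Π-1 []      = refl
    Π-1 (_ ∷ L) = trans (+-identityʳ _) (Π-1 L)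
  Π-pow-count≤ (f ∷ fs) (pf ∷ pfs) L! = ≤-trans (Π-pow-count-∷ f fs {{prime⇒nonZero pf}} L!)
    (*-monoʳ-≤ f (Π-pow-count≤ fs pfs L!))

  Π-pow-val≤ : ∀ n {L} .{{_ : NonZero n}} → Unique L → Π-pow (λ q → val q n) L ≤ n
  Π-pow-val≤ n {L} L! = begin
    Π-pow (λ q → val q n) L      ≡⟨ Π-pow-cong L (λ {q} _ → count≡ q) ⟩
    Π-pow (λ q → count q list) L ≤⟨ Π-pow-count≤ list primes L! ⟩
    product list                 ≡⟨ product≡ ⟨
    n                            ∎
    where
    open ≤-Reasoning
    open Factored (factored n)

  -- The enumeration of the primes

  firstPrimeFrom-≥ : ∀ start fuel → start ≤ firstPrimeFrom start fuel
  firstPrimeFrom-≥ start zero       = ≤-refl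
  firstPrimeFrom-≥ start (suc fuel) with prime? start
  ... | yes _ = ≤-refl
  ... | no  _ = <⇒≤ (firstPrimeFrom-≥ (suc start) fuel)

  -- True for any fuel: a search that runs out returns its current start, which has not yet passed
  -- q.
  firstPrimeFrom-least : ∀ start fuel {q} → Prime q → start ≤ q → firstPrimeFrom start fuel ≤ q
  firstPrimeFrom-least start zero       pq s≤q = s≤q
  firstPrimeFrom-least start (suc fuel) pq s≤q with prime? start
  ... | yes _ = s≤q
  ... | no ¬p = firstPrimeFrom-least (suc start) fuel pq (≤∧≢⇒< s≤q (λ { refl → ¬p pq }))

  -- Once the fuel is spent, the two bounds on q force the returned start to be q itself.
  firstPrimeFrom-prime : ∀ start fuel {q} → Prime q → start ≤ q → q ≤ start + fuel →
    Prime (firstPrimeFrom start fuel)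
  firstPrimeFrom-prime start zero       pq s≤q q≤s+f =
    subst Prime (≤-antisym (subst (_ ≤_) (+-identityʳ start) q≤s+f) s≤q) pq
  firstPrimeFrom-prime start (suc fuel) pq s≤q q≤s+f with prime? start
  ... | yes p = p
  ... | no ¬p = firstPrimeFrom-prime (suc start) fuel pq (≤∧≢⇒< s≤q (λ { refl → ¬p pq }))
                  (≤-trans q≤s+f (≤-reflexive (+-suc start fuel)))

  prime-divisor : ∀ n .{{_ : NonZero n}} → n ≢ 1 → ∃ λ q → Prime q × q ∣ n
  prime-divisor n n≢1 with factored n
  ... | record { list = [] ; product≡ = eq } = contradiction eq n≢1
  ... | record { list = q ∷ _ ; primes = pq ∷ _ ; product≡ = eq } =
    q , pq , subst (q ∣_) (sym eq) (m∣m*n _)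

  ≤⇒∣! : ∀ {m n} .{{_ : NonZero m}} → m ≤ n → m ∣ n !
  ≤⇒∣! {suc m} m≤n = ∣-trans (m∣m*n (m !)) (m≤n⇒m!∣n! m≤n)

  -- Euclid's argument: a prime divisor of n! + 1 exceeds n, and it is within reach of a search from
  -- n + 1 with fuel n!.
  nextPrime-prime : ∀ n → Prime (nextPrime n)
  nextPrime-prime n with prime-divisor (suc (n !)) (λ eq → contradiction (suc-injective eq) (m<n⇒n≢0 (1≤n! n)))
  ... | q , pq , q∣ = firstPrimeFrom-prime (suc n) (n !) pq (≰⇒> q≰n)
          (≤-trans (∣⇒≤ q∣) (s≤s (m≤n+m (n !) n)))
    where
    q≰n : ¬ q ≤ n
    q≰n q≤n = contradiction (subst Prime (∣1⇒≡1 (∣m+n∣m⇒∣n (subst (q ∣_) (+-comm 1 (n !)) q∣)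
      (≤⇒∣! {{prime⇒nonZero pq}} q≤n))) pq) ¬prime[1]

  pr-prime : ∀ j → Prime (pr (suc j))
  pr-prime j = nextPrime-prime (pr j)

  pr-< : ∀ j → pr j < pr (suc j)
  pr-< j = firstPrimeFrom-≥ (suc (pr j)) (pr j !)

  pr-least : ∀ j {q} → Prime q → pr j < q → pr (suc j) ≤ q
  pr-least j = firstPrimeFrom-least (suc (pr j)) (pr j !)

  -- Smooth numbers

  Smooth : ℕ → ℕ → Set
  Smooth y n = ∀ {q} → Prime q → q ∣ n → q ≤ y

  T-and-map : ∀ {A : Set} (f : A → Bool) → (∀ x → T (f x)) → ∀ xs → T (and (map f xs))
  T-and-map f all []       = tt
  T-and-map f all (x ∷ xs) with f x | all x
  ... | true | _ = T-and-map f all xs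

  Smooth⇒smooth : ∀ {y n} → Smooth y n → T (smooth y n)
  Smooth⇒smooth {y} {n} sm = T-and-map _ test (upTo (suc n))
    where
    test : ∀ q → T (not (⌊ prime? q ⌋ ∧ ⌊ q ∣? n ⌋) ∨ ⌊ q ≤? y ⌋)
    test q with prime? q | q ∣? n | q ≤? y
    ... | no _  | _     | _      = tt
    ... | yes _ | no _  | _      = tt
    ... | yes _ | yes _ | yes _  = tt
    ... | yes p | yes d | no q≰y = q≰y (sm p d)

  prime∣^ : ∀ {q} n e → Prime q → q ∣ n ^ e → q ∣ n
  prime∣^ n zero    pq q∣1 = contradiction (subst Prime (∣1⇒≡1 q∣1) pq) ¬prime[1]
  prime∣^ n (suc e) pq q∣ with euclidsLemma n (n ^ e) pq q∣
  ... | inj₁ q∣n  = q∣n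
  ... | inj₂ q∣n^ = prime∣^ n e pq q∣n^

  prime∣prime : ∀ {q p} → Prime q → Prime p → q ∣ p → q ≡ p
  prime∣prime pq pp q∣p with prime⇒irreducible pp q∣p
  ... | inj₁ refl = contradiction pq ¬prime[1]
  ... | inj₂ eq   = eq

  smooth-*-pr : ∀ {i I} e → Smooth (pr i) I → Smooth (pr (suc i)) (I * pr (suc i) ^ e)
  smooth-*-pr {i} {I} e sm pq q∣ with euclidsLemma I _ pq q∣
  ... | inj₁ q∣I  = ≤-trans (sm pq q∣I) (<⇒≤ (pr-< i))
  ... | inj₂ q∣p^ = ≤-reflexive (prime∣prime pq (pr-prime i) (prime∣^ _ e pq q∣p^))

  smoothNumbers : ℕ → ℕ → List ℕ
  smoothNumbers x y = map suc (filter (λ n → T? (smooth y (suc n))) (upTo x))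

  ∈-smoothNumbers : ∀ {x y n} .{{_ : NonZero n}} → n ≤ x → Smooth y n → n ∈ smoothNumbers x y
  ∈-smoothNumbers {n = suc n} n<x sm = ∈-map⁺ suc (∈-filter⁺ (λ n → T? (smooth _ (suc n))) (∈-upTo⁺ n<x) (Smooth⇒smooth sm))

  -- The valuation at p of either side is its exponent, since p divides neither cofactor.
  cancel-prime-power : ∀ {p I I′} e e′ .{{_ : NonZero I}} .{{_ : NonZero I′}} → Prime p → ¬ p ∣ I → ¬ p ∣ I′ →
    I * p ^ e ≡ I′ * p ^ e′ → I ≡ I′ × e ≡ e′
  cancel-prime-power {p} {I} {I′} e e′ pp p∤I p∤I′ eq = I≡I′ , e≡e′
    where
    instance
      p≢0 = prime⇒nonZero pp
    val-e : ∀ I e .{{_ : NonZero I}} → ¬ p ∣ I → val p (I * p ^ e) ≡ e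
    val-e I e p∤I = begin
      val p (I * p ^ e)         ≡⟨ val-* p I (p ^ e) ⟩
      val p I + val p (p ^ e)   ≡⟨ cong₂ _+_ (val-∤ p I p∤I) (val-^ p p e) ⟩
      e * val p p               ≡⟨ cong (e *_) (val-prime pp) ⟩
      e * 1                     ≡⟨ *-identityʳ e ⟩
      e                         ∎
      where
      open ≡-Reasoning
      instance _ = m^n≢0 p e
    e≡e′ : e ≡ e′
    e≡e′ = trans (sym (val-e I e p∤I)) (trans (cong (val p) eq) (val-e I′ e′ p∤I′))
    I≡I′ : I ≡ I′
    I≡I′ = *-cancelʳ-≡ I I′ (p ^ e) {{m^n≢0 p e}} (trans eq (cong (λ z → I′ * p ^ z) (sym e≡e′)))

  -- Codes for rationals supported on few primes

  -- One bit per prime says whether it goes to the numerator (`true`) or the denominator; the two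
  -- numbers are the resulting numerator and denominator.
  Code : ℕ → Set
  Code m = Vec Bool m × ℕ × ℕ

  cons : ∀ {m} → Bool → Code m → Code (suc m)
  cons b = map₁ (b ∷_)

  -- Here i and j count the primes p_1, p_2, ... already spent on numerator and denominator, and
  -- each bit spends one more. A word with l bits `true` ends with i + l and j + (m - l).
  codes : ℕ → (i j m : ℕ) → List (Code m)
  codes x i j zero    = map ([] ,_) (cartesianProduct (smoothNumbers x (pr i)) (smoothNumbers x (pr j)))
  codes x i j (suc m) = map (cons true) (codes x (suc i) j m) ++ map (cons false) (codes x i (suc j) m)

  -- The number of codes as a binomial sum.

  Σ< : ℕ → (ℕ → ℕ) → ℕ
  Σ< n f = sum (applyUpTo f n)

  Σ<-cong : ∀ n {f g} → (∀ {i} → i < n → f i ≡ g i) → Σ< n f ≡ Σ< n g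
  Σ<-cong zero    eq = refl
  Σ<-cong (suc n) eq = cong₂ _+_ (eq z<s) (Σ<-cong n (eq ∘ s≤s))

  Σ<-+ : ∀ n f g → Σ< n (λ i → f i + g i) ≡ Σ< n f + Σ< n g
  Σ<-+ zero    f g = refl
  Σ<-+ (suc n) f g = trans (cong (f 0 + g 0 +_) (Σ<-+ n (f ∘ suc) (g ∘ suc)))
    (+-interchange (f 0) (g 0) _ _)

  Σ<-last : ∀ n f → Σ< (suc n) f ≡ Σ< n f + f n
  Σ<-last n f = begin
    sum (applyUpTo f (suc n))       ≡⟨ cong sum (applyUpTo-∷ʳ f n) ⟨
    sum (applyUpTo f n ++ [ f n ])  ≡⟨ sum-++ (applyUpTo f n) [ f n ] ⟩
    Σ< n f + (f n + 0)              ≡⟨ cong (Σ< n f +_) (+-identityʳ (f n)) ⟩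
    Σ< n f + f n                    ∎
    where open ≡-Reasoning

  binomialSum : ℕ → (ℕ → ℕ) → ℕ
  binomialSum m h = Σ< (suc m) (λ l → (m C l) * h l)

  -- Pascal's rule applied to every term except the first, which joins the second sum.
  binomialSum-suc : ∀ m h → binomialSum (suc m) h ≡ binomialSum m (h ∘ suc) + binomialSum m h
  binomialSum-suc m h = begin
    1 * h 0 + Σ< (suc m) (λ l → (suc m C suc l) * h (suc l))
      ≡⟨ cong (1 * h 0 +_) (Σ<-cong (suc m) (λ {l} _ → trans
           (cong (_* h (suc l)) (sym (nCk+nC[k+1]≡[n+1]C[k+1] m l))) (*-distribʳ-+ (h (suc l)) (m C l) (m C suc l)))) ⟩
    1 * h 0 + Σ< (suc m) (λ l → (m C l) * h (suc l) + (m C suc l) * h (suc l))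
      ≡⟨ cong (1 * h 0 +_) (Σ<-+ (suc m) (λ l → (m C l) * h (suc l)) (λ l → (m C suc l) * h (suc l))) ⟩
    1 * h 0 + (binomialSum m (h ∘ suc) + Σ< (suc m) (λ l → (m C suc l) * h (suc l)))
      ≡⟨ +-x∙yz≈y∙xz (1 * h 0) (binomialSum m (h ∘ suc)) _ ⟩
    binomialSum m (h ∘ suc) + Σ< (suc (suc m)) (λ l → (m C l) * h l)
      ≡⟨ cong (binomialSum m (h ∘ suc) +_) (Σ<-last (suc m) (λ l → (m C l) * h l)) ⟩
    -- The second sum has one term too many; its coefficient m C (m + 1) is 0.
    binomialSum m (h ∘ suc) + (binomialSum m h + (m C suc m) * h (suc m))
      ≡⟨ cong (λ z → binomialSum m (h ∘ suc) + (binomialSum m h + z * h (suc m))) (k>n⇒nCk≡0 (n<1+n m)) ⟩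
    binomialSum m (h ∘ suc) + (binomialSum m h + 0)
      ≡⟨ cong (binomialSum m (h ∘ suc) +_) (+-identityʳ _) ⟩
    binomialSum m (h ∘ suc) + binomialSum m h ∎
    where open ≡-Reasoning

  -- The first bit raises either i or j, so the number of codes obeys the recursion of
  -- `binomialSum-suc`.
  length-codes-binomial : ∀ x i j m →
    length (codes x i j m) ≡ binomialSum m (λ l → Ψ x (pr (i + l)) * Ψ x (pr (j + (m ∸ l))))
  length-codes-binomial x i j zero = begin
    length (codes x i j 0)         ≡⟨ length-map ([] ,_) (cartesianProduct (smoothNumbers x (pr i)) (smoothNumbers x (pr j))) ⟩
    length (cartesianProduct (smoothNumbers x (pr i)) (smoothNumbers x (pr j)))
      ≡⟨ length-cartesianProduct (smoothNumbers x (pr i)) (smoothNumbers x (pr j)) ⟩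
    length (smoothNumbers x (pr i)) * length (smoothNumbers x (pr j))
      ≡⟨ cong₂ _*_ (length-map suc (filter (λ n → T? (smooth (pr i) (suc n))) (upTo x))) (length-map suc (filter (λ n → T? (smooth (pr j) (suc n))) (upTo x))) ⟩
    Ψ x (pr i) * Ψ x (pr j)
      ≡⟨ cong₂ (λ a b → Ψ x (pr a) * Ψ x (pr b)) (+-identityʳ i) (+-identityʳ j) ⟨
    Ψ x (pr (i + 0)) * Ψ x (pr (j + 0))
      ≡⟨ trans (+-identityʳ _) (+-identityʳ _) ⟨
    Ψ x (pr (i + 0)) * Ψ x (pr (j + 0)) + 0 + 0 ∎
    where open ≡-Reasoning
  length-codes-binomial x i j (suc m) = begin
    length (codes x i j (suc m))
      ≡⟨ length-++ (map (cons true) (codes x (suc i) j m)) ⟩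
    length (map (cons true) (codes x (suc i) j m)) + length (map (cons false) (codes x i (suc j) m))
      ≡⟨ cong₂ _+_ (length-map (cons true) (codes x (suc i) j m)) (length-map (cons false) (codes x i (suc j) m)) ⟩
    length (codes x (suc i) j m) + length (codes x i (suc j) m)
      ≡⟨ cong₂ _+_ (length-codes-binomial x (suc i) j m) (length-codes-binomial x i (suc j) m) ⟩
    binomialSum m (λ l → F (suc i + l) * F (j + (m ∸ l))) + binomialSum m (λ l → F (i + l) * F (suc j + (m ∸ l)))
      ≡⟨ cong₂ _+_ (Σ<-cong (suc m) (λ {l} _ → cong (λ z → (m C l) * (F z * F (j + (m ∸ l)))) (sym (+-suc i l))))
                   (Σ<-cong (suc m) (λ {l} l<1+m → cong (λ z → (m C l) * (F (i + l) * F z))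
                      (trans (sym (+-suc j (m ∸ l))) (cong (j +_) (sym (+-∸-assoc 1 (≤-pred l<1+m))))))) ⟩
    binomialSum m (h ∘ suc) + binomialSum m h
      ≡⟨ binomialSum-suc m h ⟨
    binomialSum (suc m) h ∎
    where
    open ≡-Reasoning
    F : ℕ → ℕ
    F z = Ψ x (pr z)
    h : ℕ → ℕ
    h l = F (i + l) * F (j + (suc m ∸ l))

  length-codes : ∀ x m → length (codes x 0 0 m) ≡ Φ̃ x m
  length-codes x m = trans (length-codes-binomial x 0 0 m)
    (trans (Σ<-cong (suc m) (λ {l} _ → sym (*-assoc (m C l) (Ψ x (pr l)) (Ψ x (pr (m ∸ l))))))
           (cong sum (sym (map-upTo (λ l → (m C l) * Ψ x (pr l) * Ψ x (pr (m ∸ l))) (suc m)))))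

  -- The next prime of L is replaced by pr (suc i) in the numerator if its exponent β vanishes, and by
  -- pr (suc j) in the denominator otherwise; a list shorter than m is padded with exponents 0.
  encode : (α β : ℕ → ℕ) → ∀ m (i j : ℕ) → List ℕ → (I J : ℕ) → Code m
  encode α β zero    i j L       I J = [] , I , J
  encode α β (suc m) i j []      I J = cons true (encode α β m (suc i) j [] I J)
  encode α β (suc m) i j (q ∷ L) I J with β q ≟ 0
  ... | yes _ = cons true  (encode α β m (suc i) j L (I * pr (suc i) ^ α q) J)
  ... | no  _ = cons false (encode α β m i (suc j) L I (J * pr (suc j) ^ β q))

  pr^≢0 : ∀ i e → NonZero (pr (suc i) ^ e)
  pr^≢0 i e = m^n≢0 (pr (suc i)) e {{prime⇒nonZero (pr-prime i)}}

  -- Encoded fractions belong to the list of codes.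

  module _ (x : ℕ) where

    -- Invariant for the numerator or the denominator: `I` is the part already rewritten in the
    -- primes up to `pr i`, `L` holds the primes still to come, and the whole product stays below
    -- the bound.
    record Side (i I : ℕ) (α : ℕ → ℕ) (L : List ℕ) : Set where
      field
        isSmooth : Smooth (pr i) I
        nonZero  : NonZero I
        bounded  : I * Π-pow α L ≤ x
        above    : All (pr i <_) L

    open Side

    -- As q is a prime above `pr i`, it is at least `pr (suc i)`, so the replacement does not
    -- increase the product. The later primes exceed q and hence also `pr (suc i)`.
    side-take : ∀ {i I α q L} → Side i I α (q ∷ L) → Prime q → All (q <_) L →
      Side (suc i) (I * pr (suc i) ^ α q) α L
    side-take {i} {I} {α} {q} {L} side pq q<L = record
      { isSmooth = smooth-*-pr {i} {I} (α q) (isSmooth side)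
      ; nonZero  = m*n≢0 I (pr (suc i) ^ α q) {{nonZero side}} {{pr^≢0 i (α q)}}
      ; bounded  = begin
          I * pr (suc i) ^ α q * Π-pow α L   ≤⟨ *-monoˡ-≤ (Π-pow α L) (*-monoʳ-≤ I (^-monoˡ-≤ (α q) pr≤q)) ⟩
          I * q ^ α q * Π-pow α L            ≡⟨ *-assoc I (q ^ α q) (Π-pow α L) ⟩
          I * (q ^ α q * Π-pow α L)          ≤⟨ bounded side ⟩
          x                                  ∎
      ; above    = All.map (≤-<-trans pr≤q) q<L
      }
      where
      open ≤-Reasoning
      pr≤q : pr (suc i) ≤ q
      pr≤q = pr-least i pq (All.head (above side))

    side-skip : ∀ {i I α q L} → Side i I α (q ∷ L) → Prime q → Side i I α L
    side-skip {i} {I} {α} {q} {L} side pq = record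
      { isSmooth = λ {q} → isSmooth side {q}
      ; nonZero  = nonZero side
      ; bounded  = ≤-trans (*-monoʳ-≤ I (m≤n*m (Π-pow α L) (q ^ α q) {{m^n≢0 q (α q) {{prime⇒nonZero pq}}}})) (bounded side)
      ; above    = All.tail (above side)
      }

    side-pad : ∀ {i I α} → Side i I α [] → Side (suc i) I α []
    side-pad {i} side = record
      { isSmooth = λ pq q∣I → ≤-trans (isSmooth side pq q∣I) (<⇒≤ (pr-< i))
      ; nonZero  = nonZero side
      ; bounded  = bounded side
      ; above    = []
      }

    ∈-codes : ∀ {α β} m {i j I J L} → length L ≤ m → All Prime L → AllPairs _<_ L →
      Side i I α L → Side j J β L → encode α β m i j L I J ∈ codes x i j m
    ∈-codes zero {I = I} {J} {[]} _ _ _ sα sβ = ∈-map⁺ ([] ,_) (∈-cartesianProduct⁺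
      (∈-smoothNumbers {{nonZero sα}} (subst (_≤ x) (*-identityʳ I) (bounded sα)) (isSmooth sα))
      (∈-smoothNumbers {{nonZero sβ}} (subst (_≤ x) (*-identityʳ J) (bounded sβ)) (isSmooth sβ)))
    ∈-codes (suc m) {L = []} _ _ _ sα sβ =
      ∈-++⁺ˡ (∈-map⁺ (cons true) (∈-codes m z≤n [] [] (side-pad sα) sβ))
    ∈-codes {α} {β} (suc m) {i} {j} {L = q ∷ L} (s≤s len) (pq ∷ pL) (q<L ∷ L↑) sα sβ with β q ≟ 0
    ... | yes _ = ∈-++⁺ˡ (∈-map⁺ (cons true) (∈-codes m len pL L↑ (side-take sα pq q<L) (side-skip sβ pq)))
    ... | no _  = ∈-++⁺ʳ (map (cons true) (codes x (suc i) j m))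
                    (∈-map⁺ (cons false) (∈-codes m len pL L↑ (side-skip sα pq) (side-take sβ pq q<L)))

  -- Recovering the exponents from a code.

  cons-injective : ∀ {m b b′} {r r′ : Code m} → cons b r ≡ cons b′ r′ → b ≡ b′ × r ≡ r′
  cons-injective refl = refl , refl

  -- The partial products of two encodings that are compared at the same stage.
  record SmoothPair (i I I′ : ℕ) : Set where
    field
      smooth₁ : Smooth (pr i) I
      smooth₂ : Smooth (pr i) I′
      nz₁     : NonZero I
      nz₂     : NonZero I′

  open SmoothPair

  pair-weaken : ∀ {i I I′} → SmoothPair i I I′ → SmoothPair (suc i) I I′
  pair-weaken {i} sp = record
    { smooth₁ = λ pq q∣ → ≤-trans (smooth₁ sp pq q∣) (<⇒≤ (pr-< i))
    ; smooth₂ = λ pq q∣ → ≤-trans (smooth₂ sp pq q∣) (<⇒≤ (pr-< i))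
    ; nz₁ = nz₁ sp ; nz₂ = nz₂ sp }

  pair-extend : ∀ {i I I′} e e′ → SmoothPair i I I′ → SmoothPair (suc i) (I * pr (suc i) ^ e) (I′ * pr (suc i) ^ e′)
  pair-extend {i} {I} {I′} e e′ sp = record
    { smooth₁ = smooth-*-pr {i} {I} e (smooth₁ sp)
    ; smooth₂ = smooth-*-pr {i} {I′} e′ (smooth₂ sp)
    ; nz₁ = m*n≢0 I _ {{nz₁ sp}} {{pr^≢0 i e}}
    ; nz₂ = m*n≢0 I′ _ {{nz₂ sp}} {{pr^≢0 i e′}} }

  pair-cancel : ∀ {i I I′} e e′ → SmoothPair i I I′ → I * pr (suc i) ^ e ≡ I′ * pr (suc i) ^ e′ → I ≡ I′ × e ≡ e′
  pair-cancel {i} e e′ sp = cancel-prime-power e e′ {{nz₁ sp}} {{nz₂ sp}} (pr-prime i)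
    (λ d → <⇒≱ (pr-< i) (smooth₁ sp (pr-prime i) d)) (λ d → <⇒≱ (pr-< i) (smooth₂ sp (pr-prime i) d))

  -- Equal codes have equal bits, so both encodings use the same new primes. The final products
  -- agree, and going backwards the exponent of the largest new prime on a side is read off and
  -- cancelled. By the first two hypotheses at most one of the exponents at q is nonzero, so the one
  -- that is not encoded is known.
  encode-injective : ∀ {α β α′ β′} → (∀ q → β q ≢ 0 → α q ≡ 0) → (∀ q → β′ q ≢ 0 → α′ q ≡ 0) →
    ∀ m {i j I J I′ J′} L → length L ≤ m → SmoothPair i I I′ → SmoothPair j J J′ →
    encode α β m i j L I J ≡ encode α′ β′ m i j L I′ J′ →
    I ≡ I′ × J ≡ J′ × (∀ {q} → q ∈ L → α q ≡ α′ q × β q ≡ β′ q)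
  encode-injective ex ex′ zero    []      _ sI sJ refl = refl , refl , λ ()
  encode-injective ex ex′ (suc m) []      _ sI sJ eq   =
    encode-injective ex ex′ m [] z≤n (pair-weaken sI) sJ (proj₂ (cons-injective eq))
  encode-injective {α} {β} {α′} {β′} ex ex′ (suc m) (q ∷ L) (s≤s len) sI sJ eq with β q ≟ 0 | β′ q ≟ 0
  ... | yes β≡0 | yes β′≡0
    with encode-injective ex ex′ m L len (pair-extend (α q) (α′ q) sI) sJ (proj₂ (cons-injective eq))
  ... | eqI , eqJ , agree with pair-cancel (α q) (α′ q) sI eqI
  ... | I≡ , α≡ = I≡ , eqJ , λ { (here refl) → α≡ , trans β≡0 (sym β′≡0) ; (there q∈) → agree q∈ }
  encode-injective {α} {β} {α′} {β′} ex ex′ (suc m) (q ∷ L) (s≤s len) sI sJ eq | no β≢0 | no β′≢0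
    with encode-injective ex ex′ m L len sI (pair-extend (β q) (β′ q) sJ) (proj₂ (cons-injective eq))
  ... | eqI , eqJ , agree with pair-cancel (β q) (β′ q) sJ eqJ
  ... | J≡ , β≡ = eqI , J≡ , λ { (here refl) → trans (ex q β≢0) (sym (ex′ q β′≢0)) , β≡ ; (there q∈) → agree q∈ }
  encode-injective ex ex′ (suc m) (q ∷ L) (s≤s len) sI sJ eq | yes _ | no _ with () ← proj₁ (cons-injective eq)
  encode-injective ex ex′ (suc m) (q ∷ L) (s≤s len) sI sJ eq | no _ | yes _ with () ← proj₁ (cons-injective eq)

module _ where

  open import Data.Nat using (_∸_; _^_)
  open import Data.Nat.Tactic.RingSolver using () renaming (solve-∀ to ℕ-solve-∀)
  open import Data.Fin.Properties using (all?; ¬∀⟶∃¬; toℕ<n; toℕ-fromℕ<)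
  open import Data.Integer as ℤ using (ℤ; +_; -_; -[1+_]; _+_; _-_; _*_; _≤_; _<_; +<+; ∣_∣; 0ℤ; 1ℤ; sign; _◃_; Positive; positive)
  open import Data.Integer.Properties
  open import Data.Integer.Divisibility.Signed using (_∣_; divides; ∣ᵤ⇒∣; ∣⇒∣ᵤ; ∣m⇒∣-m; ∣m∣n⇒∣m+n; ∣n⇒∣m*n; ∣m⇒∣m*n)
  open import Data.Integer.Tactic.RingSolver using (solve-∀)
  open import Data.List.Extrema ≤-totalOrder using (argmax; argmin; f[xs]≤f[argmax]; f[argmin]≤f[xs])
  open import Data.List.Membership.DecPropositional ℕ._≟_ using (_∈?_)

  -- Gaussian elimination on integer vectors.

  i<i+[i+j*i] : ∀ i j {k} .{{_ : Positive i}} → + j ≡ k → i < i + (i + k * i)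
  i<i+[i+j*i] i@(+ (suc n)) j refl rewrite sym (pos-* j (suc n)) = +<+ (ℕ.m<m+n (suc n) ℕ.z<s)

  -- For a valuation f this is the valuation of the product of the ratios a / b raised to the
  -- exponents `es`.
  lin : {X : Set} {s : ℕ} → (X → ℤ) → Vec (X × X) s → Vec ℕ s → ℤ
  lin f []             []       = 0ℤ
  lin f ((a , b) ∷ ps) (e ∷ es) = + e * (f a - f b) + lin f ps es

  Determined : {Q X : Set} → (Q → X → ℤ) → List Q → Set
  Determined v L = ∀ x x′ → (∀ {q} → q ∈ L → v q x ≡ v q x′) → ∀ q → v q x ≡ v q x′

  -- For valuations: if x ∏ w_i^(2 e_i) and x′ ∏ w_i^(2 e′_i) agree up to sign, then the exponents
  -- agree. Nothing is claimed yet about x and x′.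
  Independent : {Q X : Set} → (Q → X → ℤ) → ∀ {s} → Vec (X × X) s → Set
  Independent v ps = ∀ x x′ es es′ →
    (∀ q → v q x + + 2 * lin (v q) ps es ≡ v q x′ + + 2 * lin (v q) ps es′) → es ≡ es′

  module Elimination {Q X : Set} (v : Q → X → ℤ) (q₀ : Q) (a b : X) where

    D : ℤ
    D = v q₀ a - v q₀ b

    c : Q → ℤ
    c q = v q a - v q b

    -- Row q is scaled by `D` instead of being divided, so the entries stay integral. The multiple
    -- of the pivot row is chosen so that the result takes equal values at a and b.
    reduced : Q → X → ℤ
    reduced q x = D * v q x - c q * v q₀ x

    lin-reduced : ∀ {s} q (ps : Vec (X × X) s) es →
      lin (reduced q) ps es ≡ D * lin (v q) ps es - c q * lin (v q₀) ps es
    lin-reduced q []              []       = identity D (c q)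
      where
      identity : ∀ D c → 0ℤ ≡ D * 0ℤ - c * 0ℤ
      identity = solve-∀
    lin-reduced q ((a′ , b′) ∷ ps) (e ∷ es) =
      trans (cong (λ l → + e * (reduced q a′ - reduced q b′) + l) (lin-reduced q ps es))
            (identity D (c q) (+ e) (v q a′) (v q b′) (v q₀ a′) (v q₀ b′) (lin (v q) ps es) (lin (v q₀) ps es))
      where
      identity : ∀ D c e x y x₀ y₀ l l₀ →
        e * ((D * x - c * x₀) - (D * y - c * y₀)) + (D * l - c * l₀) ≡
        D * (e * (x - y) + l) - c * (e * (x₀ - y₀) + l₀)
      identity = solve-∀

    -- The terms in e cancel, as `D * c q - c q * D` is 0: the reduced rows do not see the exponent
    -- of the pivot pair.
    reduced-total : ∀ {s} q x (ps : Vec (X × X) s) e es →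
      reduced q x + + 2 * lin (reduced q) ps es ≡
      D * (v q x + + 2 * lin (v q) ((a , b) ∷ ps) (e ∷ es)) -
      c q * (v q₀ x + + 2 * lin (v q₀) ((a , b) ∷ ps) (e ∷ es))
    reduced-total q x ps e es =
      trans (cong (λ l → reduced q x + + 2 * l) (lin-reduced q ps es))
            (identity D (c q) (+ e) (v q x) (v q₀ x) (lin (v q) ps es) (lin (v q₀) ps es))
      where
      identity : ∀ D c e x x₀ l l₀ →
        (D * x - c * x₀) + + 2 * (D * l - c * l₀) ≡
        D * (x + + 2 * (e * c + l)) - c * (x₀ + + 2 * (e * D + l₀))
      identity = solve-∀

    module Extremal (≤a : ∀ x → v q₀ x ≤ v q₀ a) (b≤ : ∀ x → v q₀ b ≤ v q₀ x) (a≢b : v q₀ a ≢ v q₀ b) where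

      spread : ∀ x x′ → v q₀ x - v q₀ x′ ≤ D
      spread x x′ = +-mono-≤ (≤a x) (neg-mono-≤ (b≤ x′))

      D≢0 : D ≢ 0ℤ
      D≢0 eq = a≢b (i-j≡0⇒i≡j (v q₀ a) (v q₀ b) eq)

      instance
        D-positive : Positive D
        D-positive = positive (≤∧≢⇒< (i≤j⇒0≤j-i (b≤ a)) (D≢0 ∘ sym))

        D-nonZero : ℤ.NonZero D
        D-nonZero = ℤ.≢-nonZero D≢0

      -- The row `D * v q` is recovered from the reduced row and the pivot row, and `D` is nonzero.
      determined-step : ∀ {L} → Determined reduced L → Determined v (q₀ ∷ L)
      determined-step det x x′ agree q = *-cancelˡ-≡ D (v q x) (v q x′) (begin
        D * v q x                        ≡⟨ split (D * v q x) (c q * v q₀ x) ⟩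
        reduced q x + c q * v q₀ x       ≡⟨ cong₂ (λ r y → r + c q * y) (det x x′ agree′ q) (agree (here refl)) ⟩
        reduced q x′ + c q * v q₀ x′     ≡⟨ split (D * v q x′) (c q * v q₀ x′) ⟨
        D * v q x′                       ∎)
        where
        open ≡-Reasoning
        split : ∀ y z → y ≡ (y - z) + z
        split = solve-∀
        agree′ : ∀ {q} → q ∈ _ → reduced q x ≡ reduced q x′
        agree′ {q} q∈ = cong₂ (λ y z → D * y - c q * z) (agree (there q∈)) (agree (here refl))

      -- Doubling the exponents makes every nonzero multiple of D exceed the spread of v q₀.
      no-overlap : ∀ x x′ e e′ l → v q₀ x + + 2 * (+ e * D + l) ≡ v q₀ x′ + + 2 * (+ e′ * D + l) → ¬ e ℕ.< e′
      no-overlap x x′ e e′ l eq e<e′ with ℕ.m≤n⇒∃[o]m+o≡n e<e′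
      -- With e′ = 1 + e + d, the equation makes the two values of `v q₀` differ by 2 (1 + d) `D`,
      -- whereas no two values differ by more than `D`.
      ... | d , refl = <-irrefl refl (<-≤-trans D<diff (spread x x′))
        where
        identity₁ : ∀ x e D l → x ≡ (x + + 2 * (e * D + l)) - + 2 * (e * D + l)
        identity₁ = solve-∀
        identity₂ : ∀ x′ e d D l → ((x′ + + 2 * ((1ℤ + e + d) * D + l)) - + 2 * (e * D + l)) - x′ ≡ D + (D + + 2 * d * D)
        identity₂ = solve-∀
        diff : v q₀ x - v q₀ x′ ≡ D + (D + + 2 * + d * D)
        diff = trans (cong (_- v q₀ x′) (trans (identity₁ (v q₀ x) (+ e) D l) (cong (_- + 2 * (+ e * D + l)) eq)))
                     (identity₂ (v q₀ x′) (+ e) (+ d) D l)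
        D<diff : D < v q₀ x - v q₀ x′
        D<diff = subst (D <_) (sym diff) (i<i+[i+j*i] D (2 ℕ.* d) (pos-* 2 d))

      -- The reduced rows give `es ≡ es′`. The pivot row then has the same remaining sum on both
      -- sides, and `no-overlap` excludes both strict orders of e and e′.
      independent-step : ∀ {s} {ps : Vec (X × X) s} → Independent reduced ps → Independent v ((a , b) ∷ ps)
      independent-step {ps = ps} ind x x′ (e ∷ es) (e′ ∷ es′) eq
        with ind x x′ es es′ (λ q → trans (reduced-total q x ps e es)
               (trans (cong₂ (λ y z → D * y - c q * z) (eq q) (eq q₀)) (sym (reduced-total q x′ ps e′ es′))))
      ... | refl with ℕ.<-cmp e e′
      ... | tri≈ _ refl _ = refl
      ... | tri< e<e′ _ _ = ⊥-elim (no-overlap x x′ e e′ (lin (v q₀) ps es) (eq q₀) e<e′)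
      ... | tri> _ _ e′<e = ⊥-elim (no-overlap x′ x e′ e (lin (v q₀) ps es) (sym (eq q₀)) e′<e)

  -- If maximum and minimum agreed, f would be constant. The point x₀ found from non-constancy also
  -- serves as the starting value of both searches.
  extremal-pair : ∀ {n} (f : Fin n → ℤ) → ¬ (∀ x x′ → f x ≡ f x′) →
    ∃ λ a → ∃ λ b → (∀ x → f x ≤ f a) × (∀ x → f b ≤ f x) × f a ≢ f b
  extremal-pair {n} f ¬const with ¬∀⟶∃¬ _ _ (λ x → all? (λ x′ → f x ≟ f x′)) ¬const
  ... | x₀ , ¬const₀ = a , b , ≤a , b≤ , λ eq → ¬const₀ (λ x → trans (≡b eq x₀) (sym (≡b eq x)))
    where
    a b : Fin n
    a = argmax f x₀ (allFin n)
    b = argmin f x₀ (allFin n)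

    ≤a : ∀ x → f x ≤ f a
    ≤a x = All.lookup (f[xs]≤f[argmax] x₀ (allFin n)) (∈-allFin x)

    b≤ : ∀ x → f b ≤ f x
    b≤ x = All.lookup (f[argmin]≤f[xs] x₀ (allFin n)) (∈-allFin x)

    ≡b : f a ≡ f b → ∀ x → f x ≡ f b
    ≡b eq x = ≤-antisym (subst (f x ≤_) eq (≤a x)) (b≤ x)

  -- Gaussian elimination on the family v, in which each pair is extremal for the current pivot.
  determined⊎independent : ∀ {m n} s (v : Fin m → Fin n → ℤ) →
    (∃ λ L → length L ℕ.< s × Determined v L) ⊎ (∃ λ (ps : Vec (Fin n × Fin n) s) → Independent v ps)
  determined⊎independent zero    v = inj₂ ([] , λ { _ _ [] [] _ → refl })
  determined⊎independent (suc s) v with all? (λ q → all? (λ x → all? (λ x′ → v q x ≟ v q x′)))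
  ... | yes const = inj₁ ([] , ℕ.z<s , λ x x′ _ q → const q x x′)
  ... | no ¬const with ¬∀⟶∃¬ _ _ (λ q → all? (λ x → all? (λ x′ → v q x ≟ v q x′))) ¬const
  ... | q₀ , ¬const₀ with extremal-pair (v q₀) ¬const₀
  ... | a , b , ≤a , b≤ , a≢b with determined⊎independent s (Elimination.reduced v q₀ a b)
  ... | inj₁ (L , L<s , det) = inj₁ (q₀ ∷ L , ℕ.s<s L<s , Elimination.Extremal.determined-step v q₀ a b ≤a b≤ a≢b det)
  ... | inj₂ (ps , ind)      = inj₂ ((a , b) ∷ ps , Elimination.Extremal.independent-step v q₀ a b ≤a b≤ a≢b ind)

  -- Exponent vectors of bounded sum

  incr : ∀ {s} → Vec ℕ (suc s) → Vec ℕ (suc s)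
  incr (e ∷ es) = suc e ∷ es

  incr-injective : ∀ {s} {es es′ : Vec ℕ (suc s)} → incr es ≡ incr es′ → es ≡ es′
  incr-injective {es = _ ∷ _} {_ ∷ _} refl = refl

  -- The vectors of sum at most r, split by whether the first entry is 0 so that their number
  -- follows Pascal's rule.
  simplex : ∀ s → ℕ → List (Vec ℕ s)
  simplex zero    r       = [] ∷ []
  simplex (suc s) zero    = map (0 ∷_) (simplex s zero)
  simplex (suc s) (suc r) = map (0 ∷_) (simplex s (suc r)) ++ map incr (simplex (suc s) r)

  length-simplex : ∀ s r → length (simplex s r) ≡ (r ℕ.+ s) C s
  length-simplex zero    r       = refl
  length-simplex (suc s) zero    = begin
    length (map (Vec._∷_ 0) (simplex s 0)) ≡⟨ length-map (Vec._∷_ 0) (simplex s 0) ⟩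
    length (simplex s 0)               ≡⟨ length-simplex s 0 ⟩
    s C s                              ≡⟨ nCn≡1 s ⟩
    1                                  ≡⟨ nCn≡1 (suc s) ⟨
    suc s C suc s                      ∎
    where open ≡-Reasoning
  length-simplex (suc s) (suc r) = begin
    length (simplex (suc s) (suc r))
      ≡⟨ length-++ (map (Vec._∷_ 0) (simplex s (suc r))) ⟩
    length (map (Vec._∷_ 0) (simplex s (suc r))) ℕ.+ length (map incr (simplex (suc s) r))
      ≡⟨ cong₂ ℕ._+_ (length-map (Vec._∷_ 0) (simplex s (suc r))) (length-map incr (simplex (suc s) r)) ⟩
    length (simplex s (suc r)) ℕ.+ length (simplex (suc s) r)
      ≡⟨ cong₂ ℕ._+_ (length-simplex s (suc r)) (length-simplex (suc s) r) ⟩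
    (suc r ℕ.+ s) C s ℕ.+ (r ℕ.+ suc s) C suc s
      ≡⟨ cong (λ n → n C s ℕ.+ (r ℕ.+ suc s) C suc s) (ℕ.+-suc r s) ⟨
    (r ℕ.+ suc s) C s ℕ.+ (r ℕ.+ suc s) C suc s
      ≡⟨ nCk+nC[k+1]≡[n+1]C[k+1] (r ℕ.+ suc s) s ⟩
    (suc r ℕ.+ suc s) C suc s ∎
    where open ≡-Reasoning

  simplex-unique : ∀ s r → Unique (simplex s r)
  simplex-unique zero    r       = [] ∷ []
  simplex-unique (suc s) zero    = Uniqueₚ.map⁺ (λ { refl → refl }) (simplex-unique s zero)
  simplex-unique (suc s) (suc r) = Uniqueₚ.++⁺
    (Uniqueₚ.map⁺ (λ { refl → refl }) (simplex-unique s (suc r)))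
    (Uniqueₚ.map⁺ incr-injective (simplex-unique (suc s) r))
    (λ (∈₁ , ∈₂) → disjoint (∈-map⁻ (Vec._∷_ 0) ∈₁) (∈-map⁻ incr ∈₂))
    where
    disjoint : ∀ {es : Vec ℕ (suc s)} {P : Vec ℕ s → Set} {P′ : Vec ℕ (suc s) → Set} →
      (∃ λ fs → P fs × es ≡ 0 ∷ fs) → ¬ (∃ λ fs → P′ fs × es ≡ incr fs)
    disjoint (_ , _ , refl) (_ ∷ _ , _ , ())

  simplex-sum : ∀ s r → All (λ es → Vec.sum es ℕ.≤ r) (simplex s r)
  simplex-sum zero    r       = z≤n ∷ []
  simplex-sum (suc s) zero    = Allₚ.map⁺ (simplex-sum s zero)
  simplex-sum (suc s) (suc r) = Allₚ.++⁺ (Allₚ.map⁺ (simplex-sum s (suc r)))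
    (Allₚ.map⁺ (All.map (λ { {_ ∷ _} le → s≤s le }) (simplex-sum (suc s) r)))

  -- Monomials with bounded exponents.

  monomial : ∀ {A : Set} {s} → (A → ℕ) → Vec A s → Vec ℕ s → ℕ
  monomial f []       []       = 1
  monomial f (p ∷ ps) (e ∷ es) = f p ℕ.^ e ℕ.* monomial f ps es

  monomial-nonZero : ∀ {A : Set} {s} {f : A → ℕ} → (∀ p → NonZero (f p)) → ∀ (ps : Vec A s) es → NonZero (monomial f ps es)
  monomial-nonZero f≢0 []       []       = _
  monomial-nonZero f≢0 (p ∷ ps) (e ∷ es) =
    ℕ.m*n≢0 _ _ {{ℕ.m^n≢0 _ e {{f≢0 p}}}} {{monomial-nonZero f≢0 ps es}}

  monomial-≤ : ∀ {A : Set} {s} {f : A → ℕ} {B r} .{{_ : NonZero B}} → (∀ p → f p ℕ.≤ B) →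
    ∀ (ps : Vec A s) es → Vec.sum es ℕ.≤ r → monomial f ps es ℕ.≤ B ℕ.^ r
  monomial-≤ {f = f} {B} {r} f≤B ps es Σes≤r = ℕ.≤-trans (go ps es) (ℕ.^-monoʳ-≤ B Σes≤r)
    where
    go : ∀ {s} (ps : Vec _ s) es → monomial f ps es ℕ.≤ B ℕ.^ Vec.sum es
    go []       []       = ℕ.≤-refl
    go (p ∷ ps) (e ∷ es) = ℕ.≤-trans (ℕ.*-mono-≤ (ℕ.^-monoˡ-≤ e (f≤B p)) (go ps es))
      (ℕ.≤-reflexive (sym (ℕ.^-distribˡ-+-* B e (Vec.sum es))))

  -- Residues modulo a prime

  i*i≡∣i∣*∣i∣ : ∀ i → i * i ≡ + (∣ i ∣ ℕ.* ∣ i ∣)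
  i*i≡∣i∣*∣i∣ (+ n)    = sym (pos-* n n)
  i*i≡∣i∣*∣i∣ -[1+ n ] = refl

  ∣∧<⇒≡0 : ∀ {p n} → p ℕ.∣ n → n ℕ.< p → n ≡ 0
  ∣∧<⇒≡0 {n = zero}  _   _   = refl
  ∣∧<⇒≡0 {n = suc _} p∣n n<p = contradiction (ℕ.∣⇒≤ p∣n) (ℕ.<⇒≱ n<p)

  module Modular (p : ℕ) where

    infix 4 _≈_
    record _≈_ (i j : ℤ) : Set where
      constructor mk
      field diff : + p ∣ i - j
    open _≈_

    from-mod : ∀ {i j} → i ≡ℤ j [mod p ] → i ≈ j
    from-mod d = mk (∣ᵤ⇒∣ d)

    to-∣ : ∀ {i j} → i ≈ j → p ℕ.∣ ∣ i - j ∣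
    to-∣ e = ∣⇒∣ᵤ (diff e)

    ≈-reflexive : ∀ {i j} → i ≡ j → i ≈ j
    ≈-reflexive {i} refl = mk (divides 0ℤ (+-inverseʳ i))

    ≈-sym : ∀ {i j} → i ≈ j → j ≈ i
    ≈-sym {i} {j} e = mk (subst (+ p ∣_) (identity i j) (∣m⇒∣-m (diff e)))
      where
      identity : ∀ i j → - (i - j) ≡ j - i
      identity = solve-∀

    ≈-trans : ∀ {i j k} → i ≈ j → j ≈ k → i ≈ k
    ≈-trans {i} {j} {k} e f = mk (subst (+ p ∣_) (identity i j k) (∣m∣n⇒∣m+n (diff e) (diff f)))
      where
      identity : ∀ i j k → (i - j) + (j - k) ≡ i - k
      identity = solve-∀

    *-cong : ∀ {i j k l} → i ≈ j → k ≈ l → i * k ≈ j * l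
    *-cong {i} {j} {k} {l} e f = mk (subst (+ p ∣_) (identity i j k l)
      (∣m∣n⇒∣m+n (∣m⇒∣m*n k (diff e)) (∣n⇒∣m*n j (diff f))))
      where
      identity : ∀ i j k l → (i - j) * k + j * (k - l) ≡ i * k - j * l
      identity = solve-∀

    *-congˡ : ∀ i {k l} → k ≈ l → i * k ≈ i * l
    *-congˡ i = *-cong (≈-reflexive {i} refl)

    *-congʳ : ∀ k {i j} → i ≈ j → i * k ≈ j * k
    *-congʳ k e = *-cong e (≈-reflexive {k} refl)

    ≈-setoid : Setoid 0ℓ 0ℓ
    ≈-setoid = record { Carrier = ℤ ; _≈_ = _≈_ ; isEquivalence = record
      { refl = ≈-reflexive refl ; sym = ≈-sym ; trans = ≈-trans } }

    small-≡ : ∀ {i j} → i ≈ j → ∣ i - j ∣ ℕ.< p → i ≡ j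
    small-≡ {i} {j} e lt = i-j≡0⇒i≡j i j (∣i∣≡0⇒i≡0 (∣∧<⇒≡0 (to-∣ e) lt))

    residue-≡ : ∀ {x y} → x ℕ.< p → y ℕ.< p → + x ≈ + y → x ≡ y
    residue-≡ {x} {y} x<p y<p e = +-injective (small-≡ e (ℕ.≤-<-trans
      (subst (λ z → ∣ z ∣ ℕ.≤ x ℕ.⊔ y) (sym (m-n≡m⊖n x y)) (∣m⊝n∣≤m⊔n x y)) (ℕ.⊔-lub x<p y<p)))

    ≈0⇒∣ : ∀ {n} → + n ≈ 0ℤ → p ℕ.∣ n
    ≈0⇒∣ {n} e = subst (p ℕ.∣_) (cong ∣_∣ (+-identityʳ (+ n))) (to-∣ e)

    module _ (p-prime : Prime p) where

      *-cancelˡ : ∀ {c i j} → ¬ p ℕ.∣ ∣ c ∣ → c * i ≈ c * j → i ≈ j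
      *-cancelˡ {c} {i} {j} p∤c e with euclidsLemma ∣ c ∣ ∣ i - j ∣ p-prime
        (subst (p ℕ.∣_) (trans (cong ∣_∣ (identity c i j)) (abs-* c (i - j))) (to-∣ e))
        where
        identity : ∀ c i j → c * i - c * j ≡ c * (i - j)
        identity = solve-∀
      ... | inj₁ p∣c = contradiction p∣c p∤c
      ... | inj₂ p∣d = mk (∣ᵤ⇒∣ p∣d)

      unit-∤ : ∀ {n} → 1 ℕ.≤ n → n ℕ.< p → ¬ p ℕ.∣ n
      unit-∤ {suc n} _ n<p p∣n = ℕ.<⇒≱ n<p (ℕ.∣⇒≤ p∣n)

      -- Quotients inside the subgroup.

      module Group {t} (G : Subgroup p t) where
        open Subgroup G

        element-∤ : ∀ {g} → g ∈ elems → ¬ p ℕ.∣ g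
        element-∤ g∈ with All.lookup inRange g∈
        ... | 1≤g , g<p = unit-∤ 1≤g g<p

        -- The residue n / m belongs to G, stated without inverses.
        Ratio : ℕ → ℕ → Set
        Ratio m n = ∃ λ h → h ∈ elems × + h * + m ≈ + n

        -- Multiplication by g is injective on the elements, hence surjective.
        quotient : ∀ {g h} → g ∈ elems → h ∈ elems → Ratio g h
        quotient {g} {h} g∈ h∈ with any? (λ d → p ℕ.∣? ∣ + d * + g - + h ∣) elems
        ... | yes found with find found
        ...   | d , d∈ , p∣ = d , d∈ , mk (∣ᵤ⇒∣ p∣)
        -- If no multiple of g were h, multiplication by g would inject the elements into the list
        -- with h removed.
        quotient {g} {h} g∈ h∈ | no none with ∈-∃++ h∈
        ... | as , bs , elems≡ = contradiction too-short (ℕ.<⇒≱ ℕ.≤-refl)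
          where
          image : ∀ {d} → d ∈ elems → ∃ λ y → y ∈ as ++ bs × + d * + g ≈ + y
          image {d} d∈ with closed d∈ g∈
          ... | y , y∈ , y≡ with ≈-sym (≈-trans (from-mod y≡) (≈-reflexive (pos-* d g)))
          ... | dg≈y with ∈-remove as (subst (y ∈_) elems≡ y∈)
          ... | inj₂ y∈′ = y , y∈′ , dg≈y
          ... | inj₁ refl = contradiction (lose d∈ (to-∣ dg≈y)) none

          too-short : suc (length (as ++ bs)) ℕ.≤ length (as ++ bs)
          too-short = subst (ℕ._≤ length (as ++ bs)) (trans (cong length elems≡) (length-remove as))
            (pigeonhole (λ d y → + d * + g ≈ + y) unique image
              (λ {d} {d′} d∈ d′∈ e e′ → residue-≡ (proj₂ (All.lookup inRange d∈)) (proj₂ (All.lookup inRange d′∈))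
                (*-cancelˡ {+ g} (element-∤ g∈) (≈-trans (≈-reflexive (*-comm (+ g) (+ d)))
                  (≈-trans e (≈-trans (≈-sym e′) (≈-reflexive (*-comm (+ d′) (+ g)))))))))

        ratio-1 : Ratio 1 1
        ratio-1 = 1 , one∈ , ≈-reflexive refl

        product-in : ∀ {g h} → g ∈ elems → h ∈ elems → ∃ λ q → q ∈ elems × + q ≈ + g * + h
        product-in {g} {h} g∈ h∈ with closed g∈ h∈
        ... | q , q∈ , q≡ = q , q∈ , ≈-trans (from-mod q≡) (≈-reflexive (pos-* g h))

        ratio-* : ∀ {m n m′ n′} → Ratio m n → Ratio m′ n′ → Ratio (m ℕ.* m′) (n ℕ.* n′)
        ratio-* {m} {n} {m′} {n′} (h , h∈ , e) (h′ , h′∈ , e′) with product-in h∈ h′∈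
        ... | q , q∈ , q≈ = q , q∈ , (begin
          + q * + (m ℕ.* m′)           ≈⟨ *-cong q≈ (≈-reflexive (pos-* m m′)) ⟩
          (+ h * + h′) * (+ m * + m′)  ≡⟨ identity (+ h) (+ h′) (+ m) (+ m′) ⟩
          (+ h * + m) * (+ h′ * + m′)  ≈⟨ *-cong e e′ ⟩
          + n * + n′                   ≡⟨ pos-* n n′ ⟨
          + (n ℕ.* n′)                 ∎)
          where
          open SetoidReasoning ≈-setoid
          identity : ∀ a b c d → (a * b) * (c * d) ≡ (a * c) * (b * d)
          identity = solve-∀

        ratio-^ : ∀ {m n} e → Ratio m n → Ratio (m ℕ.^ e) (n ℕ.^ e)
        ratio-^ zero    ρ = ratio-1
        ratio-^ (suc e) ρ = ratio-* ρ (ratio-^ e ρ)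

        ratio-monomial : ∀ {A : Set} {s} {f g : A → ℕ} → (∀ x → Ratio (f x) (g x)) →
          ∀ (ps : Vec A s) es → Ratio (monomial f ps es) (monomial g ps es)
        ratio-monomial ρ []       []       = ratio-1
        ratio-monomial ρ (p ∷ ps) (e ∷ es) = ratio-* (ratio-^ e (ρ p)) (ratio-monomial ρ ps es)

  -- The points of V as fractions with a finite index set.

  lookup-injective : ∀ {A : Set} {xs : List A} → Unique xs → ∀ {i j} → lookup xs i ≡ lookup xs j → i ≡ j
  lookup-injective (x∉ ∷ xs!) {Fin.zero}  {Fin.zero}  eq = refl
  lookup-injective (x∉ ∷ xs!) {Fin.zero}  {Fin.suc j} eq = contradiction eq (All.lookup x∉ (∈-lookup j))
  lookup-injective (x∉ ∷ xs!) {Fin.suc i} {Fin.zero}  eq = contradiction (sym eq) (All.lookup x∉ (∈-lookup i))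
  lookup-injective (x∉ ∷ xs!) {Fin.suc i} {Fin.suc j} eq = cong Fin.suc (lookup-injective xs! eq)

  odd-prime≢2* : ∀ {p n} → Prime p → 2 ℕ.< p → p ≢ 2 ℕ.* n
  odd-prime≢2* {p} {n} pp 2<p eq with prime⇒irreducible pp (subst (2 ℕ.∣_) (sym eq) (ℕ.m∣m*n n))
  ... | inj₂ refl = ℕ.<-irrefl refl 2<p

  signs : List Sign
  signs = Sign.+ ∷ Sign.- ∷ []

  ∈-signs : ∀ σ → σ ∈ signs
  ∈-signs Sign.+ = here refl
  ∈-signs Sign.- = there (here refl)

  record Fractions {p t : ℕ} (k a : ℕ) (G : Subgroup p t) (N : ℕ) : Set where
    open Modular p
    open Subgroup G
    field
      p-prime     : Prime p
      1<k         : 1 ℕ.< k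
      k<p         : k ℕ.< p
      1≤a         : 1 ℕ.≤ a
      a<p         : a ℕ.< p
      x g v       : Fin N → ℕ
      u           : Fin N → ℤ
      x<p         : ∀ i → x i ℕ.< p
      x-injective : ∀ {i j} → x i ≡ x j → i ≡ j
      g∈          : ∀ i → g i ∈ elems
      x≈ag        : ∀ i → + x i ≈ + a * + g i
      1≤v         : ∀ i → 1 ℕ.≤ v i
      num≤k       : ∀ i → ∣ u i ∣ ℕ.≤ k
      v≤k         : ∀ i → v i ℕ.≤ k
      u≈vx        : ∀ i → u i ≈ + v i * + x i

    num : Fin N → ℕ
    num i = ∣ u i ∣

  module Family {p t k a N : ℕ} {G : Subgroup p t} (F : Fractions k a G N) where

    open Fractions F
    open Modular p
    open Group p-prime G
    open Subgroup G

    instance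
      k≢0 : NonZero k
      k≢0 = >-nonZero (ℕ.<⇒≤ 1<k)

    u≈vag : ∀ i → u i ≈ + v i * (+ a * + g i)
    u≈vag i = ≈-trans (u≈vx i) (*-congˡ (+ v i) (x≈ag i))

    v∤ : ∀ i → ¬ p ℕ.∣ v i
    v∤ i = unit-∤ p-prime (1≤v i) (ℕ.≤-<-trans (v≤k i) k<p)

    vag∤ : ∀ i → ¬ p ℕ.∣ v i ℕ.* (a ℕ.* g i)
    vag∤ i d with euclidsLemma (v i) (a ℕ.* g i) p-prime d
    ... | inj₁ p∣v  = v∤ i p∣v
    ... | inj₂ p∣ag with euclidsLemma a (g i) p-prime p∣ag
    ...   | inj₁ p∣a = unit-∤ p-prime 1≤a a<p p∣a
    ...   | inj₂ p∣g = element-∤ (g∈ i) p∣g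

    -- The numerator is congruent to v a g, a product of units modulo p.
    num≢0 : ∀ i → num i ≢ 0
    num≢0 i eq = vag∤ i (≈0⇒∣ (≈-trans (≈-reflexive (trans (pos-* (v i) (a ℕ.* g i)) (cong (+ v i *_) (pos-* a (g i)))))
      (≈-trans (≈-sym (u≈vag i)) (≈-reflexive (∣i∣≡0⇒i≡0 eq)))))

    instance
      num-nonZero : ∀ {i} → NonZero (num i)
      num-nonZero {i} = ℕ.≢-nonZero (num≢0 i)

      v-nonZero : ∀ {i} → NonZero (v i)
      v-nonZero {i} = >-nonZero (1≤v i)

    -- Equal fractions have equal residues, because the denominators lie between 1 and k < p and so
    -- can be cancelled modulo p.
    cross-injective : ∀ {i j} → u i * + v j ≡ u j * + v i → i ≡ j
    cross-injective {i} {j} eq = x-injective (residue-≡ (x<p i) (x<p j)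
      (*-cancelˡ p-prime {+ v j} (v∤ j) (*-cancelˡ p-prime {+ v i} (v∤ i) (begin
        + v i * (+ v j * + x i)   ≡⟨ identity (+ v i) (+ v j) (+ x i) ⟩
        (+ v i * + x i) * + v j   ≈⟨ *-congʳ (+ v j) (u≈vx i) ⟨
        u i * + v j               ≡⟨ eq ⟩
        u j * + v i               ≈⟨ *-congʳ (+ v i) (u≈vx j) ⟩
        (+ v j * + x j) * + v i   ≡⟨ *-comm (+ v j * + x j) (+ v i) ⟩
        + v i * (+ v j * + x j)   ∎))))
      where
      open SetoidReasoning ≈-setoid
      identity : ∀ a b c → a * (b * c) ≡ (a * c) * b
      identity = solve-∀

    ν : ℕ → Fin N → ℤ
    ν q i = + val q (num i) - + val q (v i)

    -- A finite family of rows, as the elimination requires; the rows at non-primes are zero.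
    ν≤k : Fin (suc k) → Fin N → ℤ
    ν≤k q = ν (toℕ q)

    ν⇒val : ∀ q i j → ν q i ≡ ν q j → val q (num i) ℕ.+ val q (v j) ≡ val q (num j) ℕ.+ val q (v i)
    ν⇒val q i j eq = +-injective (trans (identity (+ val q (num i)) (+ val q (v i)) (+ val q (v j)))
      (trans (cong (λ z → z + (+ val q (v i) + + val q (v j))) eq) (identity′ (+ val q (num j)) (+ val q (v i)) (+ val q (v j)))))
      where
      identity : ∀ a b c → a + c ≡ (a - b) + (b + c)
      identity = solve-∀
      identity′ : ∀ a b c → (a - c) + (b + c) ≡ a + b
      identity′ = solve-∀

    -- Numerators and denominators are at most k, so all valuations at q > k vanish and those at q ≤
    -- k decide.
    ν-ext : ∀ i j → (∀ q → ν≤k q i ≡ ν≤k q j) → num i ℕ.* v j ≡ num j ℕ.* v i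
    ν-ext i j eq = val-ext _ _ {{ℕ.m*n≢0 (num i) (v j)}} {{ℕ.m*n≢0 (num j) (v i)}} λ q → begin
      val q (num i ℕ.* v j)          ≡⟨ val-* q (num i) (v j) ⟩
      val q (num i) ℕ.+ val q (v j)  ≡⟨ vals q ⟩
      val q (num j) ℕ.+ val q (v i)  ≡⟨ val-* q (num j) (v i) ⟨
      val q (num j ℕ.* v i)          ∎
      where
      open ≡-Reasoning
      vals : ∀ q → val q (num i) ℕ.+ val q (v j) ≡ val q (num j) ℕ.+ val q (v i)
      vals q with q ℕ.<? suc k
      ... | yes q≤k = ν⇒val q i j (subst (λ z → ν z i ≡ ν z j) (toℕ-fromℕ< q≤k) (eq (fromℕ< q≤k)))
      ... | no q≰k  = trans (cong₂ ℕ._+_ (big (num≤k i)) (big (v≤k j))) (sym (cong₂ ℕ._+_ (big (num≤k j)) (big (v≤k i))))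
        where
        big : ∀ {n} .{{_ : NonZero n}} → n ℕ.≤ k → val q n ≡ 0
        big n≤k = val-> q _ (ℕ.≤-<-trans n≤k (ℕ.≮⇒≥ q≰k))

    -- Integer multiplication unfolds to the product of the signs attached to the product of the
    -- absolute values.
    sign-cross : ∀ i j → sign (u i) ≡ sign (u j) → num i ℕ.* v j ≡ num j ℕ.* v i → u i * + v j ≡ u j * + v i
    sign-cross i j = cong₂ (λ σ n → (σ Sign.* Sign.+) ◃ n)

    -- The case in which few primes determine all valuations.

    module Small {s} (L : List (Fin (suc k))) (L<s : length L ℕ.< suc s) (det : Determined ν≤k L) where

      selected? = λ q → prime? q ×-dec (q ∈? map toℕ L)

      -- `L` may contain repetitions and non-primes. Filtering an increasing list by membership
      -- leaves its primes in increasing order, as the encoding requires.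
      primes : List ℕ
      primes = filter selected? (upTo (suc k))

      primes-prime : All Prime primes
      primes-prime = All.tabulate (λ q∈ → proj₁ (proj₂ (∈-filter⁻ selected? {xs = upTo (suc k)} q∈)))

      primes-sorted : AllPairs ℕ._<_ primes
      primes-sorted = AllPairsₚ.filter⁺ selected? (AllPairsₚ.applyUpTo⁺₁ id (suc k) (λ i<j _ → i<j))

      primes-unique : Unique primes
      primes-unique = AllPairs.map ℕ.<⇒≢ primes-sorted

      primes-length : length primes ℕ.≤ s
      primes-length = ℕ.≤-trans (unique-⊆-length primes-unique
          (λ q∈ → proj₂ (proj₂ (∈-filter⁻ selected? {xs = upTo (suc k)} q∈))))
        (subst (ℕ._≤ s) (sym (length-map toℕ L)) (ℕ.≤-pred L<s))

      -- The positive and negative parts of ν_q, that is, the exponents of q in the numerator and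
      -- denominator in lowest terms.
      α β : Fin N → ℕ → ℕ
      α i q = val q (num i) ∸ val q (v i)
      β i q = val q (v i) ∸ val q (num i)

      -- The initial state of the invariant: nothing is rewritten, `pr 0` is 1, and the product of
      -- the prime powers is at most n ≤ k.
      side : ∀ {e : ℕ → ℕ} n .{{_ : NonZero n}} → n ℕ.≤ k → (∀ q → e q ℕ.≤ val q n) → Side (k ^ 2) 0 1 e primes
      side {e} n n≤k e≤ = record
        { isSmooth = λ _ q∣1 → ℕ.∣⇒≤ q∣1
        ; nonZero  = _
        ; bounded  = begin
            1 ℕ.* Π-pow e primes            ≡⟨ ℕ.*-identityˡ _ ⟩
            Π-pow e primes                  ≤⟨ Π-pow-mono primes (λ q∈ → prime⇒nonZero (All.lookup primes-prime q∈)) e≤ ⟩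
            Π-pow (λ q → val q n) primes    ≤⟨ Π-pow-val≤ n primes-unique ⟩
            n                               ≤⟨ n≤k ⟩
            k                               ≤⟨ ℕ.m≤m*n k (k ^ 1) {{ℕ.m^n≢0 k 1}} ⟩
            k ^ 2                           ∎
        ; above    = All.map (λ pq → ℕ.nonTrivial⇒n>1 _ {{prime⇒nonTrivial pq}}) primes-prime
        }
        where open ℕ.≤-Reasoning

      code : Fin N → Sign × Code s
      code i = sign (u i) , encode (α i) (β i) s 0 0 primes 1 1

      code∈ : ∀ i → code i ∈ cartesianProduct signs (codes (k ^ 2) 0 0 s)
      code∈ i = ∈-cartesianProduct⁺ (∈-signs (sign (u i))) (∈-codes (k ^ 2) s primes-length primes-prime primes-sorted
        (side (num i) (num≤k i) (λ q → ℕ.m∸n≤m (val q (num i)) (val q (v i))))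
        (side (v i) (v≤k i) (λ q → ℕ.m∸n≤m (val q (v i)) (val q (num i)))))

      exclusive : ∀ m n → n ∸ m ≢ 0 → m ∸ n ≡ 0
      exclusive m n n∸m≢0 = ℕ.m≤n⇒m∸n≡0 (ℕ.<⇒≤ (ℕ.m∸n≢0⇒n<m {n} {m} n∸m≢0))

      ∸-ext : ∀ m n m′ n′ → m ∸ n ≡ m′ ∸ n′ → n ∸ m ≡ n′ ∸ m′ → + m - + n ≡ + m′ - + n′
      ∸-ext m n m′ n′ eq eq′ = trans (split m n) (trans (cong₂ (λ y z → + y - + z) eq eq′) (sym (split m′ n′)))
        where
        split : ∀ m n → + m - + n ≡ + (m ∸ n) - + (n ∸ m)
        split zero    zero    = refl
        split zero    (suc n) = refl
        split (suc m) zero    = refl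
        split (suc m) (suc n) = trans (identity (+ m) (+ n)) (split m n)
          where
          identity : ∀ m n → (1ℤ + m) - (1ℤ + n) ≡ m - n
          identity = solve-∀

      -- The code gives back the valuations at the primes of `L`, these give all valuations and
      -- hence the absolute value of the fraction, and the sign is stored separately.
      code-injective : ∀ {i j} → code i ≡ code j → i ≡ j
      code-injective {i} {j} eq with ,-injective eq
      ... | sign≡ , enc≡ = cross-injective (sign-cross i j sign≡ (ν-ext i j (det i j agree)))
        where
        one-smooth : SmoothPair 0 1 1
        one-smooth = record { smooth₁ = λ _ → ℕ.∣⇒≤ ; smooth₂ = λ _ → ℕ.∣⇒≤ ; nz₁ = _ ; nz₂ = _ }
        agree : ∀ {q} → q ∈ L → ν≤k q i ≡ ν≤k q j
        agree {q} q∈ with prime? (toℕ q)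
        ... | yes pq = ∸-ext (val (toℕ q) (num i)) (val (toℕ q) (v i)) (val (toℕ q) (num j)) (val (toℕ q) (v j))
                         (proj₁ both) (proj₂ both)
          where
          both = proj₂ (proj₂ (encode-injective
            (λ q → exclusive (val q (num i)) (val q (v i))) (λ q → exclusive (val q (num j)) (val q (v j)))
            s primes primes-length one-smooth one-smooth enc≡))
            (∈-filter⁺ selected? (∈-upTo⁺ (toℕ<n q)) (pq , ∈-map⁺ toℕ q∈))
        -- An index in `L` that is not prime was filtered out, but all valuations vanish there.
        ... | no ¬pq = cong₂ (λ y z → + y - + z) (trans (none (num i)) (sym (none (num j)))) (trans (none (v i)) (sym (none (v j))))
          where
          none : ∀ n → val (toℕ q) n ≡ 0
          none n with val (toℕ q) n ℕ.≟ 0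
          ... | yes eq = eq
          ... | no neq = contradiction (proj₁ (val≢0⇒prime-divisor (toℕ q) n neq)) ¬pq

      bound : N ℕ.≤ 2 ℕ.* Φ̃ (k ^ 2) s
      bound = begin
        N                  ≡⟨ length-tabulate id ⟨
        length (allFin N)  ≤⟨ pigeonhole (λ i c → code i ≡ c) (Uniqueₚ.allFin⁺ N) (λ {i} _ → code i , code∈ i , refl)
                                (λ _ _ eq eq′ → code-injective (trans eq (sym eq′))) ⟩
        length (cartesianProduct signs (codes (k ^ 2) 0 0 s))  ≡⟨ length-cartesianProduct signs (codes (k ^ 2) 0 0 s) ⟩
        2 ℕ.* length (codes (k ^ 2) 0 0 s)     ≡⟨ cong (2 ℕ.*_) (length-codes (k ^ 2) s) ⟩
        2 ℕ.* Φ̃ (k ^ 2) s  ∎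
        where open ℕ.≤-Reasoning

    -- The case of s independent ratios.

    module Large {s} (ps : Vec (Fin N × Fin N) s) (ind : Independent ν≤k ps)
                 (r : ℕ) (2K<p : 2 ℕ.* k ^ (8 ℕ.* r ℕ.+ 2) ℕ.< p) where

      -- (x a / x b)² = upper / lower modulo p
      upper₁ lower₁ upper lower : Fin N × Fin N → ℕ
      upper₁ (a , b) = num a ℕ.* v b
      lower₁ (a , b) = num b ℕ.* v a
      upper ab = upper₁ ab ℕ.* upper₁ ab
      lower ab = lower₁ ab ℕ.* lower₁ ab

      instance
        upper₁-nonZero : ∀ {ab} → NonZero (upper₁ ab)
        upper₁-nonZero {a , b} = ℕ.m*n≢0 (num a) (v b)
        lower₁-nonZero : ∀ {ab} → NonZero (lower₁ ab)
        lower₁-nonZero {a , b} = ℕ.m*n≢0 (num b) (v a)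
        upper-nonZero : ∀ {ab} → NonZero (upper ab)
        upper-nonZero {ab} = ℕ.m*n≢0 (upper₁ ab) (upper₁ ab)
        lower-nonZero : ∀ {ab} → NonZero (lower ab)
        lower-nonZero {ab} = ℕ.m*n≢0 (lower₁ ab) (lower₁ ab)
        U-nonZero : ∀ {es} → NonZero (monomial upper ps es)
        U-nonZero {es} = monomial-nonZero (λ _ → upper-nonZero) ps es
        L-nonZero : ∀ {es} → NonZero (monomial lower ps es)
        L-nonZero {es} = monomial-nonZero (λ _ → lower-nonZero) ps es

      U L : Vec ℕ s → ℕ
      U = monomial upper ps
      L = monomial lower ps

      square-bound : ∀ {m n} → m ℕ.≤ k → n ℕ.≤ k → (m ℕ.* n) ℕ.* (m ℕ.* n) ℕ.≤ k ^ 4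
      square-bound m≤k n≤k = ℕ.≤-trans (ℕ.*-mono-≤ (ℕ.*-mono-≤ m≤k n≤k) (ℕ.*-mono-≤ m≤k n≤k))
        (ℕ.≤-reflexive (identity k))
        where
        identity : ∀ k → (k ℕ.* k) ℕ.* (k ℕ.* k) ≡ k ℕ.* (k ℕ.* (k ℕ.* (k ℕ.* 1)))
        identity = ℕ-solve-∀

      -- With d = g a′ / g b′ in G, the factor a cancels and d (u b′ v a′) is congruent to u a′ v
      -- b′. `upper` and `lower` are built from absolute values, and squaring removes the sign.
      ratio : ∀ ab → Ratio (lower ab) (upper ab)
      ratio (a′ , b′) with quotient (g∈ b′) (g∈ a′)
      ... | d , d∈ , dg≈g with product-in d∈ d∈
      ... | q , q∈ , q≈dd = q , q∈ , (begin
        + q * + lower (a′ , b′)                                  ≈⟨ *-cong q≈dd (≈-reflexive (abs² b′ a′)) ⟩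
        (+ d * + d) * ((u b′ * + v a′) * (u b′ * + v a′))         ≡⟨ identity (+ d) (u b′ * + v a′) ⟩
        (+ d * (u b′ * + v a′)) * (+ d * (u b′ * + v a′))         ≈⟨ *-cong step step ⟩
        (u a′ * + v b′) * (u a′ * + v b′)                         ≡⟨ abs² a′ b′ ⟨
        + upper (a′ , b′)                                        ∎)
        where
        open SetoidReasoning ≈-setoid
        identity : ∀ d w → (d * d) * (w * w) ≡ (d * w) * (d * w)
        identity = solve-∀
        identity′ : ∀ d v g a v′ → d * (v * (a * g) * v′) ≡ (v′ * (a * (d * g))) * v
        identity′ = solve-∀
        abs² : ∀ i j → + ((num i ℕ.* v j) ℕ.* (num i ℕ.* v j)) ≡ (u i * + v j) * (u i * + v j)
        abs² i j = trans (cong (λ z → + (z ℕ.* z)) (sym (abs-* (u i) (+ v j)))) (sym (i*i≡∣i∣*∣i∣ (u i * + v j)))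
        step : + d * (u b′ * + v a′) ≈ u a′ * + v b′
        step = begin
          + d * (u b′ * + v a′)                              ≈⟨ *-congˡ (+ d) (*-congʳ (+ v a′) (u≈vag b′)) ⟩
          + d * (+ v b′ * (+ a * + g b′) * + v a′)           ≡⟨ identity′ (+ d) (+ v b′) (+ g b′) (+ a) (+ v a′) ⟩
          (+ v a′ * (+ a * (+ d * + g b′))) * + v b′         ≈⟨ *-congʳ (+ v b′) (*-congˡ (+ v a′) (*-congˡ (+ a) dg≈g)) ⟩
          (+ v a′ * (+ a * + g a′)) * + v b′                 ≈⟨ *-congʳ (+ v b′) (u≈vag a′) ⟨
          u a′ * + v b′                                      ∎

      -- The residue of the rational number x_i ∏ w^(2 e) is a h, stated without division.
      Represents : Fin N × Vec ℕ s → ℕ → Set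
      Represents (i , es) h = + a * + h * (+ v i * + L es) ≈ u i * + U es

      represented : ∀ i es → ∃ λ h → h ∈ elems × Represents (i , es) h
      represented i es with ratio-monomial ratio ps es
      ... | h , h∈ , hL≈U with product-in (g∈ i) h∈
      ... | q , q∈ , q≈gh = q , q∈ , (begin
        + a * + q * (+ v i * + L es)                    ≈⟨ *-congʳ (+ v i * + L es) (*-congˡ (+ a) q≈gh) ⟩
        + a * (+ g i * + h) * (+ v i * + L es)          ≡⟨ identity (+ a) (+ g i) (+ h) (+ v i) (+ L es) ⟩
        (+ v i * (+ a * + g i)) * (+ h * + L es)        ≈⟨ *-cong (≈-sym (u≈vag i)) hL≈U ⟩
        u i * + U es                                    ∎)
        where
        open SetoidReasoning ≈-setoid
        identity : ∀ a g h v l → a * (g * h) * (v * l) ≡ (v * (a * g)) * (h * l)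
        identity = solve-∀

      -- Numerator of the first rational times denominator of the second; symmetry of `cross` in the
      -- two arguments means that the rationals are equal.
      cross : Fin N → Vec ℕ s → Fin N → Vec ℕ s → ℤ
      cross i es j fs = (u i * + U es) * (+ v j * + L fs)

      cross-≈ : ∀ {i j es fs h} → Represents (i , es) h → Represents (j , fs) h → cross i es j fs ≈ cross j fs i es
      cross-≈ {i} {j} {es} {fs} {h} ρ ρ′ = begin
        (u i * + U es) * (+ v j * + L fs)                                ≈⟨ *-congʳ (+ v j * + L fs) ρ ⟨
        (+ a * + h * (+ v i * + L es)) * (+ v j * + L fs)                ≡⟨ identity (+ a * + h) (+ v i * + L es) (+ v j * + L fs) ⟩
        (+ a * + h * (+ v j * + L fs)) * (+ v i * + L es)                ≈⟨ *-congʳ (+ v i * + L es) ρ′ ⟩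
        (u j * + U fs) * (+ v i * + L es)                                ∎
        where
        open SetoidReasoning ≈-setoid
        identity : ∀ a b c → (a * b) * c ≡ (a * c) * b
        identity = solve-∀

      abs-cross : ∀ i es j fs → ∣ cross i es j fs ∣ ≡ (num i ℕ.* U es) ℕ.* (v j ℕ.* L fs)
      abs-cross i es j fs = trans (abs-* (u i * + U es) (+ v j * + L fs))
        (cong₂ ℕ._*_ (abs-* (u i) (+ U es)) (abs-* (+ v j) (+ L fs)))

      -- Each monomial is at most k^(4r), and `u i` and `v j` contribute one further k each. This is
      -- the source of the exponent 8r + 2.
      cross-bound : ∀ i es j fs → Vec.sum es ℕ.≤ r → Vec.sum fs ℕ.≤ r → ∣ cross i es j fs ∣ ℕ.≤ k ^ (8 ℕ.* r ℕ.+ 2)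
      cross-bound i es j fs Σes≤r Σfs≤r = begin
        ∣ cross i es j fs ∣                             ≡⟨ abs-cross i es j fs ⟩
        (num i ℕ.* U es) ℕ.* (v j ℕ.* L fs)             ≤⟨ ℕ.*-mono-≤ (ℕ.*-mono-≤ (num≤k i) U≤) (ℕ.*-mono-≤ (v≤k j) L≤) ⟩
        (k ℕ.* (k ^ 4) ^ r) ℕ.* (k ℕ.* (k ^ 4) ^ r)     ≡⟨ cong (λ z → (k ℕ.* z) ℕ.* (k ℕ.* z)) (ℕ.^-*-assoc k 4 r) ⟩
        k ^ suc (4 ℕ.* r) ℕ.* k ^ suc (4 ℕ.* r)         ≡⟨ ℕ.^-distribˡ-+-* k (suc (4 ℕ.* r)) (suc (4 ℕ.* r)) ⟨
        k ^ (suc (4 ℕ.* r) ℕ.+ suc (4 ℕ.* r))           ≡⟨ cong (k ^_) (identity r) ⟩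
        k ^ (8 ℕ.* r ℕ.+ 2)                             ∎
        where
        open ℕ.≤-Reasoning
        identity : ∀ r → suc (4 ℕ.* r) ℕ.+ suc (4 ℕ.* r) ≡ 8 ℕ.* r ℕ.+ 2
        identity = ℕ-solve-∀
        instance _ = ℕ.m^n≢0 k 4
        U≤ : U es ℕ.≤ (k ^ 4) ^ r
        U≤ = monomial-≤ (λ (a , b) → square-bound (num≤k a) (v≤k b)) ps es Σes≤r
        L≤ : L fs ℕ.≤ (k ^ 4) ^ r
        L≤ = monomial-≤ (λ (a , b) → square-bound (num≤k b) (v≤k a)) ps fs Σfs≤r

      -- `upper` and `lower` are squares, which produces the factor 2 in `Independent`.
      val-monomial : ∀ q {t} (ps : Vec (Fin N × Fin N) t) es →
        + val q (monomial upper ps es) - + val q (monomial lower ps es) ≡ + 2 * lin (ν q) ps es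
      val-monomial q []              []       = cong (λ z → + z - + z) (val-factors q [] [] refl)
      val-monomial q ((a , b) ∷ ps) (e ∷ es) = trans (cong₂ (λ y z → + y - + z)
          (val-step (num a) (v b) (monomial upper ps es)) (val-step (num b) (v a) (monomial lower ps es)))
        (trans (cong₂ (λ y z → (y + + val q (monomial upper ps es)) - (z + + val q (monomial lower ps es)))
                 (cast (num a) (v b)) (cast (num b) (v a)))
        (trans (identity (+ e) (+ val q (num a)) (+ val q (v b)) (+ val q (num b)) (+ val q (v a))
                         (+ val q (monomial upper ps es)) (+ val q (monomial lower ps es)))
        (trans (cong (λ z → + 2 * (+ e * (ν q a - ν q b)) + z) (val-monomial q ps es))
               (sym (*-distribˡ-+ (+ 2) (+ e * (ν q a - ν q b)) (lin (ν q) ps es))))))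
        where
        instance
          _ = monomial-nonZero (λ ab → upper-nonZero {ab}) ps es
          _ = monomial-nonZero (λ ab → lower-nonZero {ab}) ps es
        val-step : ∀ m n M .{{_ : NonZero m}} .{{_ : NonZero n}} .{{_ : NonZero M}} →
          val q (((m ℕ.* n) ℕ.* (m ℕ.* n)) ^ e ℕ.* M) ≡ e ℕ.* ((val q m ℕ.+ val q n) ℕ.+ (val q m ℕ.+ val q n)) ℕ.+ val q M
        val-step m n M = trans (val-* q (((m ℕ.* n) ℕ.* (m ℕ.* n)) ^ e) M) (cong (ℕ._+ val q M)
          (trans (val-^ q ((m ℕ.* n) ℕ.* (m ℕ.* n)) e) (cong (e ℕ.*_)
          (trans (val-* q (m ℕ.* n) (m ℕ.* n)) (cong₂ ℕ._+_ (val-* q m n) (val-* q m n))))))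
          where
          instance
            mn≢0 = ℕ.m*n≢0 m n
            mnmn≢0 = ℕ.m*n≢0 (m ℕ.* n) (m ℕ.* n)
            pow≢0 = ℕ.m^n≢0 ((m ℕ.* n) ℕ.* (m ℕ.* n)) e
        cast : ∀ m n → + (e ℕ.* ((val q m ℕ.+ val q n) ℕ.+ (val q m ℕ.+ val q n))) ≡
          + e * ((+ val q m + + val q n) + (+ val q m + + val q n))
        cast m n = pos-* e _
        identity : ∀ e na vb nb va x y → (e * ((na + vb) + (na + vb)) + x) - (e * ((nb + va) + (nb + va)) + y) ≡
          + 2 * (e * ((na - va) - (nb - vb))) + (x - y)
        identity = solve-∀

      cross⇒ν : ∀ q {i es j fs} → cross i es j fs ≡ cross j fs i es →
        ν q i + + 2 * lin (ν q) ps es ≡ ν q j + + 2 * lin (ν q) ps fs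
      cross⇒ν q {i} {es} {j} {fs} eq = begin
        ν q i + + 2 * lin (ν q) ps es        ≡⟨ cong (λ z → ν q i + z) (val-monomial q ps es) ⟨
        ν q i + (+ val q (U es) - + val q (L es))
          ≡⟨ identity (+ val q (num i)) (+ val q (v i)) (+ val q (U es)) (+ val q (L es)) (+ val q (v j)) (+ val q (L fs)) ⟩
        + ((val q (num i) ℕ.+ val q (U es)) ℕ.+ (val q (v j) ℕ.+ val q (L fs))) - R
          ≡⟨ cong (λ z → + z - R) vals ⟩
        + ((val q (num j) ℕ.+ val q (U fs)) ℕ.+ (val q (v i) ℕ.+ val q (L es))) - R
          ≡⟨ identity′ (+ val q (num j)) (+ val q (v j)) (+ val q (U fs)) (+ val q (L fs)) (+ val q (v i)) (+ val q (L es)) ⟨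
        ν q j + (+ val q (U fs) - + val q (L fs))
          ≡⟨ cong (λ z → ν q j + z) (val-monomial q ps fs) ⟩
        ν q j + + 2 * lin (ν q) ps fs        ∎
        where
        open ≡-Reasoning
        R : ℤ
        -- The total valuation of the two denominators, subtracted on both sides.
        R = (+ val q (v i) + + val q (L es)) + (+ val q (v j) + + val q (L fs))
        identity : ∀ n v x y v′ y′ → (n - v) + (x - y) ≡ ((n + x) + (v′ + y′)) - ((v + y) + (v′ + y′))
        identity = solve-∀
        identity′ : ∀ n v x y v′ y′ → (n - v) + (x - y) ≡ ((n + x) + (v′ + y′)) - ((v′ + y′) + (v + y))
        identity′ = solve-∀
        val-cross : ∀ i es j fs → val q ∣ cross i es j fs ∣ ≡
          (val q (num i) ℕ.+ val q (U es)) ℕ.+ (val q (v j) ℕ.+ val q (L fs))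
        val-cross i es j fs = trans (cong (val q) (abs-cross i es j fs))
          (trans (val-* q (num i ℕ.* U es) (v j ℕ.* L fs) {{ℕ.m*n≢0 (num i) (U es)}} {{ℕ.m*n≢0 (v j) (L fs)}})
                 (cong₂ ℕ._+_ (val-* q (num i) (U es)) (val-* q (v j) (L fs))))
        vals = trans (sym (val-cross i es j fs)) (trans (cong (val q ∘ ∣_∣) eq) (val-cross j fs i es))

      -- Two cross products that are congruent and at most k^(8r+2) in absolute value are equal,
      -- since 2 k^(8r+2) < p. Comparing valuations gives `es ≡ fs`; cancelling the monomials then
      -- leaves two equal fractions.
      represents-injective : ∀ {i es j fs h} → Vec.sum es ℕ.≤ r → Vec.sum fs ℕ.≤ r →
        Represents (i , es) h → Represents (j , fs) h → (i , es) ≡ (j , fs)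
      represents-injective {i} {es} {j} {fs} Σes≤r Σfs≤r ρ ρ′ = conclude (ind i j es fs (λ q → cross⇒ν (toℕ q) eq)) eq
        where
        eq : cross i es j fs ≡ cross j fs i es
        eq = small-≡ (cross-≈ ρ ρ′) (ℕ.≤-<-trans (∣i-j∣≤∣i∣+∣j∣ (cross i es j fs) (cross j fs i es))
          (ℕ.≤-<-trans (ℕ.+-mono-≤ (cross-bound i es j fs Σes≤r Σfs≤r)
             -- The summand 0 appears because `2 * n` unfolds to `n + (n + 0)`.
             (ℕ.≤-trans (cross-bound j fs i es Σfs≤r Σes≤r) (ℕ.m≤m+n _ 0))) 2K<p))
        identity : ∀ u v x y → (u * x) * (v * y) ≡ (u * v) * (x * y)
        identity = solve-∀
        conclude : es ≡ fs → cross i es j fs ≡ cross j fs i es → (i , es) ≡ (j , fs)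
        conclude refl eq = cong (_, es) (cross-injective (*-cancelʳ-≡ _ _ (+ U es * + L es)
          {{i*j≢0 (+ U es) (+ L es)}}
          (trans (sym (identity (u i) (+ v j) (+ U es) (+ L es))) (trans eq (identity (u j) (+ v i) (+ U es) (+ L es))))))

      bound : N ℕ.* ((r ℕ.+ s) C s) ℕ.≤ t
      bound = begin
        N ℕ.* ((r ℕ.+ s) C s)
          ≡⟨ cong₂ ℕ._*_ (length-tabulate {n = N} id) (length-simplex s r) ⟨
        length (allFin N) ℕ.* length (simplex s r)
          ≡⟨ length-cartesianProduct (allFin N) (simplex s r) ⟨
        length (cartesianProduct (allFin N) (simplex s r))
          ≤⟨ pigeonhole Represents (Uniqueₚ.cartesianProduct⁺ (Uniqueₚ.allFin⁺ N) (simplex-unique s r))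
               (λ { {i , es} _ → represented i es })
               (λ { {i , es} {j , fs} ∈₁ ∈₂ → represents-injective (sum≤r ∈₁) (sum≤r ∈₂) }) ⟩
        length elems
          ≡⟨ order ⟩
        t ∎
        where
        open ℕ.≤-Reasoning
        sum≤r : ∀ {i es} → (i , es) ∈ cartesianProduct (allFin N) (simplex s r) → Vec.sum es ℕ.≤ r
        sum≤r ∈₁ = All.lookup (simplex-sum s r) (proj₂ (∈-cartesianProduct⁻ (allFin N) (simplex s r) ∈₁))

  -- The elimination applied to the points of V.

  family-bound : ∀ {p t k a N} {G : Subgroup p t} → Fractions k a G N → ∀ s r → 2 ℕ.* k ^ (8 ℕ.* r ℕ.+ 2) ℕ.< p →
    (N ℕ.≤ 2 ℕ.* Φ̃ (k ^ 2) s) ⊎ (N ℕ.* ((r ℕ.+ suc s) C suc s) ℕ.≤ t)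
  family-bound F s r 2K<p with determined⊎independent (suc s) (Family.ν≤k F)
  ... | inj₁ (L , L<s , det) = inj₁ (Family.Small.bound F L L<s det)
  ... | inj₂ (ps , ind)      = inj₂ (Family.Large.bound F ps ind r 2K<p)

  fractions : ∀ {p t k a} (G : Subgroup p t) {xs} → Prime p → 1 ℕ.< k → k ℕ.< p → 1 ℕ.≤ a → a ℕ.< p →
    Unique xs → All (InV G k a) xs → Fractions k a G (length xs)
  fractions {p} {k = k} {a} G {xs} p-prime 1<k k<p 1≤a a<p xs! xs∈V = record
    { p-prime     = p-prime
    ; 1<k         = 1<k
    ; k<p         = k<p
    ; 1≤a         = 1≤a
    ; a<p         = a<p
    ; x           = lookup xs
    ; g           = λ i → let _ , (g , _) , _ = x∈V i in g
    ; v           = λ i → let _ , _ , (_ , v , _) = x∈V i in v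
    ; u           = λ i → let _ , _ , (u , _) = x∈V i in u
    ; x<p         = λ i → let x<p , _ = x∈V i in x<p
    ; x-injective = lookup-injective xs!
    ; g∈          = λ i → let _ , (_ , g∈ , _) , _ = x∈V i in g∈
    ; x≈ag        = λ i → let _ , (g , _ , x≡ag) , _ = x∈V i in ≈-trans (from-mod x≡ag) (≈-reflexive (pos-* a g))
    ; 1≤v         = λ i → let _ , _ , (_ , _ , 1≤v , _) = x∈V i in 1≤v
    ; num≤k       = λ i → let _ , _ , (_ , _ , _ , u≤k , _) = x∈V i in u≤k
    ; v≤k         = λ i → let _ , _ , (_ , _ , _ , _ , v≤k , _) = x∈V i in v≤k
    ; u≈vx        = λ i → let _ , _ , (_ , v , _ , _ , _ , u≡vx) = x∈V i in
                            ≈-trans (from-mod u≡vx) (≈-reflexive (pos-* v (lookup xs i)))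
    }
    where
    open Modular p
    x∈V : ∀ i → InV G k a (lookup xs i)
    x∈V i = All.lookup xs∈V (∈-lookup i)

open import Data.Nat using (_+_; _*_; _∸_; _^_; _≤_; _<_)
open import Data.Nat.Divisibility using (_∣_)
open import Data.Nat.Properties

-- The two inequalities between p and the powers of k express that r is the integer part of log(p/2)
-- / (8 log k) - 1/4. The maximum becomes a disjunction, with the binomial coefficient multiplied
-- out.
theorem1p7 : (p t k s a r : ℕ) →
    Prime p → 2 < p →
    1 ≤ t → t ∣ (p ∸ 1) →
    1 < k →
    1 ≤ s →
    1 ≤ a → a < p →
    2 * k ^ (8 * r + 2) ≤ p →
    p < 2 * k ^ (8 * suc r + 2) →
    (G : Subgroup p t) →
    (xs : List ℕ) → Unique xs → All (InV G k a) xs →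
    (length xs ≤ 2 * Φ̃ (k ^ 2) (s ∸ 1)) ⊎ (length xs * ((r + s) C s) ≤ t)
theorem1p7 p t k (suc s) a r p-prime 2<p _ _ 1<k _ 1≤a a<p 2K≤p _ G xs xs! xs∈V =
  family-bound (fractions G p-prime 1<k k<p 1≤a a<p xs! xs∈V) s r 2K<p
  where
  2K<p : 2 * k ^ (8 * r + 2) < p
  -- Equality is impossible because p is an odd prime.
  2K<p = ≤∧≢⇒< 2K≤p (odd-prime≢2* {n = k ^ (8 * r + 2)} p-prime 2<p ∘ sym)

  k<p : k < p
  k<p = begin-strict
    k                       ≤⟨ m≤m*n k (k ^ (8 * r + 1)) ⟩
    k ^ suc (8 * r + 1)     ≡⟨ cong (k ^_) (+-suc (8 * r) 1) ⟨
    k ^ (8 * r + 2)         ≤⟨ m≤n*m (k ^ (8 * r + 2)) 2 ⟩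
    2 * k ^ (8 * r + 2)     <⟨ 2K<p ⟩
    p                       ∎
    where
    open ≤-Reasoning
    instance
      k≢0 = >-nonZero (<⇒≤ 1<k)
      k^≢0 = m^n≢0 k (8 * r + 1)
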